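{- Let $\mathcal{D}$ be a set of $n$ unit disks in the plane and let $G_{\mathcal{D}}$ be the intersection graph of $\mathcal{D}$. Then an induced bipartite subgraph of $G_{\mathcal{D}}$ with at least $|\mathrm{MBS}(G_{\mathcal{D}})|/3$ vertices can be computed in $O(n^4)$ time, where $\mathrm{MBS}(G_{\mathcal{D}})$ is a maximum induced bipartite subgraph of $G_{\mathcal{D}}$ and $|\mathrm{MBS}(G_{\mathcal{D}})|$ is its number of vertices.
   Context: Unit disks are closed disks of radius 1 in the plane. The intersection graph of $\mathcal{D}$ has one vertex per disk, two vertices being adjacent if and only if the corresponding disks intersect. Running times count elementary operations, including arithmetic on real numbers, at unit cost. -}

module Defs where

open import Level using (0ℓ)
open import Algebra.Bundles using (CommutativeRing)
open import Algebra.Definitions using (Invertible)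
open import Data.Bool using (Bool; true; false; not; _∧_)
open import Data.Fin using (Fin; zero; suc; toℕ)
open import Data.Fin.Subset using (Subset; _∈_; ∣_∣)
open import Data.Nat as ℕ using (ℕ; zero; suc)
open import Data.Product using (∃; ∃-syntax; _×_; _,_; proj₁)
open import Data.Vec using (tabulate)
open import Function using (_∘_; _on_)
open import Relation.Binary using (Rel; IsDecTotalOrder; Symmetric)
open import Relation.Binary.PropositionalEquality using (_≡_; _≢_; ≢-sym)
open import Relation.Nullary using (¬_; does; yes; no)
open import Relation.Unary using (Pred; _≬_)

------------------------------------------------------------------------
-- Real numbers

-- The reals as a Dedekind-complete totally ordered field.  The order is
-- decidable because a real RAM compares two reals in one step.
record Reals : Set₁ where
  field
    commutativeRing : CommutativeRing 0ℓ 0ℓ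

  open CommutativeRing commutativeRing public

  infix 4 _≤_

  field
    _≤_             : Rel Carrier 0ℓ
    isDecTotalOrder : IsDecTotalOrder _≈_ _≤_
    0≉1             : ¬ (0# ≈ 1#)
    inverse         : ∀ x → ¬ (x ≈ 0#) → Invertible _≈_ 1# _*_ x
    +-mono-≤        : ∀ {x y} z → x ≤ y → (x + z) ≤ (y + z)
    *-nonNeg        : ∀ {x y} → 0# ≤ x → 0# ≤ y → 0# ≤ (x * y)

  open IsDecTotalOrder isDecTotalOrder public
    using (_≟_; _≤?_)

  UpperBound : Pred Carrier 0ℓ → Carrier → Set
  UpperBound P b = ∀ x → P x → x ≤ b

  field
    complete : (P : Pred Carrier 0ℓ) → ∃ P → ∃ (UpperBound P) →
               ∃[ s ] UpperBound P s × (∀ b → UpperBound P b → s ≤ b)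

------------------------------------------------------------------------
-- Simple graphs

record Graph (V : Set) : Set₁ where
  field
    Adj    : Rel V 0ℓ
    sym    : Symmetric Adj
    irrefl : ∀ {v} → ¬ Adj v v

induced : ∀ {V} → Graph V → (P : Pred V 0ℓ) → Graph (∃ P)
induced G P = record
  { Adj    = Adj on proj₁
  ; sym    = sym
  ; irrefl = irrefl
  }
  where open Graph G

Bipartite : ∀ {V} → Graph V → Set
Bipartite {V} G =
  ∃ λ (side : V → Bool) → ∀ u v → Graph.Adj G u v → side u ≢ side v

InducesBipartite : ∀ {n} → Graph (Fin n) → Subset n → Set
InducesBipartite G S = Bipartite (induced G (_∈ S))

IsMBS : ∀ {n} → Graph (Fin n) → Subset n → Set
IsMBS G M = InducesBipartite G M ×
            (∀ S → InducesBipartite G S → ∣ S ∣ ℕ.≤ ∣ M ∣)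

------------------------------------------------------------------------
-- Unit disks in the plane

module Plane (ℝ : Reals) where
  open Reals ℝ

  record Point : Set where
    constructor point
    field
      xcoord ycoord : Carrier
  open Point public

  record UnitDisk : Set where
    constructor disk
    field
      centre : Point
  open UnitDisk public

  -- Squared, since distance ≤ 1 exactly when squared distance ≤ 1.
  dist² : Point → Point → Carrier
  dist² p q = (xcoord p - xcoord q) * (xcoord p - xcoord q) +
              (ycoord p - ycoord q) * (ycoord p - ycoord q)

  points : UnitDisk → Pred Point 0ℓ
  points d p = dist² (centre d) p ≤ 1#

  Intersect : Rel UnitDisk 0ℓ
  Intersect d e = points d ≬ points e

  SameDisk : Rel UnitDisk 0ℓ
  SameDisk d e = xcoord (centre d) ≈ xcoord (centre e) ×
                 ycoord (centre d) ≈ ycoord (centre e)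

  intersectionGraph : ∀ {n} → (Fin n → UnitDisk) → Graph (Fin n)
  intersectionGraph D = record
    { Adj    = λ i j → i ≢ j × Intersect (D i) (D j)
    ; sym    = λ { (i≢j , p , p∈i , p∈j) → ≢-sym i≢j , p , p∈j , p∈i }
    ; irrefl = λ { (i≢i , _) → i≢i _≡_.refl }
    }

------------------------------------------------------------------------
-- Programs for a real RAM

-- Storage consists of named registers and named arrays, separately for
-- natural numbers (counters, addresses, flags) and for reals.  Natural
-- numbers are not multiplied, and there is no rounding from reals to
-- naturals: at unit cost these operations would make the machine
-- unreasonably powerful.

Name : Set
Name = ℕ

infixl 6 _⊕_ _⊖_
infixl 7 _⊛_ _⊘_

data NExp : Set where
  lit     : ℕ → NExp
  reg     : Name → NExp
  arr     : Name → NExp → NExp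
  _⊕_ _⊖_ : NExp → NExp → NExp

data RExp : Set where
  𝟘 𝟙             : RExp
  reg             : Name → RExp
  arr             : Name → NExp → RExp
  _⊕_ _⊖_ _⊛_ _⊘_ : RExp → RExp → RExp

data BExp : Set where
  _≤ⁿ_ _=ⁿ_ : NExp → NExp → BExp
  _≤ʳ_ _=ʳ_ : RExp → RExp → BExp
  notᵇ      : BExp → BExp
  _andᵇ_    : BExp → BExp → BExp

infix  5 _≔ⁿ_ _≔ʳ_ _[_]≔ⁿ_ _[_]≔ʳ_
infixr 4 _⨾_

data Program : Set where
  skip          : Program
  _≔ⁿ_          : Name → NExp → Program
  _≔ʳ_          : Name → RExp → Program
  _[_]≔ⁿ_       : Name → NExp → NExp → Program
  _[_]≔ʳ_       : Name → NExp → RExp → Program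
  _⨾_           : Program → Program → Program
  if_then_else_ : BExp → Program → Program → Program
  while_loop_   : BExp → Program → Program

-- One unit for every constant, register access, array access, arithmetic
-- operation, comparison and connective that is evaluated.

costⁿ : NExp → ℕ
costⁿ (lit k)   = 1
costⁿ (reg v)   = 1
costⁿ (arr a e) = 1 ℕ.+ costⁿ e
costⁿ (e ⊕ f)   = 1 ℕ.+ (costⁿ e ℕ.+ costⁿ f)
costⁿ (e ⊖ f)   = 1 ℕ.+ (costⁿ e ℕ.+ costⁿ f)

costʳ : RExp → ℕ
costʳ 𝟘         = 1
costʳ 𝟙         = 1
costʳ (reg v)   = 1
costʳ (arr a e) = 1 ℕ.+ costⁿ e
costʳ (e ⊕ f)   = 1 ℕ.+ (costʳ e ℕ.+ costʳ f)
costʳ (e ⊖ f)   = 1 ℕ.+ (costʳ e ℕ.+ costʳ f)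
costʳ (e ⊛ f)   = 1 ℕ.+ (costʳ e ℕ.+ costʳ f)
costʳ (e ⊘ f)   = 1 ℕ.+ (costʳ e ℕ.+ costʳ f)

costᵇ : BExp → ℕ
costᵇ (e ≤ⁿ f)   = 1 ℕ.+ (costⁿ e ℕ.+ costⁿ f)
costᵇ (e =ⁿ f)   = 1 ℕ.+ (costⁿ e ℕ.+ costⁿ f)
costᵇ (e ≤ʳ f)   = 1 ℕ.+ (costʳ e ℕ.+ costʳ f)
costᵇ (e =ʳ f)   = 1 ℕ.+ (costʳ e ℕ.+ costʳ f)
costᵇ (notᵇ b)   = 1 ℕ.+ costᵇ b
costᵇ (b andᵇ c) = 1 ℕ.+ (costᵇ b ℕ.+ costᵇ c)

-- f with its value at k replaced by v.
update : {A : Set} → (ℕ → A) → ℕ → A → ℕ → A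
update f k v j with j ℕ.≟ k
... | yes _ = v
... | no  _ = f j

padded : {A : Set} {n : ℕ} → A → (Fin n → A) → ℕ → A
padded {n = zero}  d f k       = d
padded {n = suc n} d f zero    = f zero
padded {n = suc n} d f (suc k) = padded d (f ∘ suc) k

module RealRAM (ℝ : Reals) where
  open Reals ℝ
  open Plane ℝ public

  record State : Set where
    field
      nreg : Name → ℕ
      narr : Name → ℕ → ℕ
      rreg : Name → Carrier
      rarr : Name → ℕ → Carrier
  open State public

  -- Total by the convention a ÷ 0 = 0, which a program could equally
  -- impose by testing the divisor first.
  _÷_ : Carrier → Carrier → Carrier
  a ÷ b with b ≟ 0#
  ... | yes _   = 0#
  ... | no b≉0 = a * proj₁ (inverse b b≉0)

  evalⁿ : NExp → State → ℕ
  evalⁿ (lit k)   σ = k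
  evalⁿ (reg v)   σ = nreg σ v
  evalⁿ (arr a e) σ = narr σ a (evalⁿ e σ)
  evalⁿ (e ⊕ f)   σ = evalⁿ e σ ℕ.+ evalⁿ f σ
  evalⁿ (e ⊖ f)   σ = evalⁿ e σ ℕ.∸ evalⁿ f σ

  evalʳ : RExp → State → Carrier
  evalʳ 𝟘         σ = 0#
  evalʳ 𝟙         σ = 1#
  evalʳ (reg v)   σ = rreg σ v
  evalʳ (arr a e) σ = rarr σ a (evalⁿ e σ)
  evalʳ (e ⊕ f)   σ = evalʳ e σ + evalʳ f σ
  evalʳ (e ⊖ f)   σ = evalʳ e σ - evalʳ f σ
  evalʳ (e ⊛ f)   σ = evalʳ e σ * evalʳ f σ
  evalʳ (e ⊘ f)   σ = evalʳ e σ ÷ evalʳ f σ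

  evalᵇ : BExp → State → Bool
  evalᵇ (e ≤ⁿ f)   σ = does (evalⁿ e σ ℕ.≤? evalⁿ f σ)
  evalᵇ (e =ⁿ f)   σ = does (evalⁿ e σ ℕ.≟ evalⁿ f σ)
  evalᵇ (e ≤ʳ f)   σ = does (evalʳ e σ ≤? evalʳ f σ)
  evalᵇ (e =ʳ f)   σ = does (evalʳ e σ ≟ evalʳ f σ)
  evalᵇ (notᵇ b)   σ = not (evalᵇ b σ)
  evalᵇ (b andᵇ c) σ = evalᵇ b σ ∧ evalᵇ c σ

  infix 3 ⟨_,_⟩⇓[_]_

  -- ⟨ P , σ ⟩⇓[ t ] τ : started in σ, the program P halts in τ after
  -- t elementary operations.
  data ⟨_,_⟩⇓[_]_ : Program → State → ℕ → State → Set where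

    ⇓skip : ∀ {σ} → ⟨ skip , σ ⟩⇓[ 1 ] σ

    ⇓≔ⁿ : ∀ {σ v e} →
      ⟨ v ≔ⁿ e , σ ⟩⇓[ 1 ℕ.+ costⁿ e ]
      record σ { nreg = update (nreg σ) v (evalⁿ e σ) }

    ⇓≔ʳ : ∀ {σ v e} →
      ⟨ v ≔ʳ e , σ ⟩⇓[ 1 ℕ.+ costʳ e ]
      record σ { rreg = update (rreg σ) v (evalʳ e σ) }

    ⇓[]≔ⁿ : ∀ {σ a i e} →
      ⟨ a [ i ]≔ⁿ e , σ ⟩⇓[ 1 ℕ.+ (costⁿ i ℕ.+ costⁿ e) ]
      record σ { narr = update (narr σ) a
                          (update (narr σ a) (evalⁿ i σ) (evalⁿ e σ)) }

    ⇓[]≔ʳ : ∀ {σ a i e} →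
      ⟨ a [ i ]≔ʳ e , σ ⟩⇓[ 1 ℕ.+ (costⁿ i ℕ.+ costʳ e) ]
      record σ { rarr = update (rarr σ) a
                          (update (rarr σ a) (evalⁿ i σ) (evalʳ e σ)) }

    ⇓⨾ : ∀ {σ τ υ P Q s t} →
      ⟨ P , σ ⟩⇓[ s ] τ → ⟨ Q , τ ⟩⇓[ t ] υ →
      ⟨ P ⨾ Q , σ ⟩⇓[ s ℕ.+ t ] υ

    ⇓then : ∀ {σ τ b P Q t} → evalᵇ b σ ≡ true →
      ⟨ P , σ ⟩⇓[ t ] τ →
      ⟨ if b then P else Q , σ ⟩⇓[ 1 ℕ.+ (costᵇ b ℕ.+ t) ] τ

    ⇓else : ∀ {σ τ b P Q t} → evalᵇ b σ ≡ false →
      ⟨ Q , σ ⟩⇓[ t ] τ →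
      ⟨ if b then P else Q , σ ⟩⇓[ 1 ℕ.+ (costᵇ b ℕ.+ t) ] τ

    ⇓loop : ∀ {σ τ υ b P s t} → evalᵇ b σ ≡ true →
      ⟨ P , σ ⟩⇓[ s ] τ → ⟨ while b loop P , τ ⟩⇓[ t ] υ →
      ⟨ while b loop P , σ ⟩⇓[ 1 ℕ.+ (costᵇ b ℕ.+ (s ℕ.+ t)) ] υ

    ⇓exit : ∀ {σ b P} → evalᵇ b σ ≡ false →
      ⟨ while b loop P , σ ⟩⇓[ 1 ℕ.+ costᵇ b ] σ

  -- Natural register 0 holds n; real arrays 0 and 1 hold the x- and
  -- y-coordinates of the centres.  All other storage is zero.
  input : ∀ {n} → (Fin n → UnitDisk) → State
  input {n} D = record
    { nreg = λ { zero → n ; (suc _) → 0 }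
    ; narr = λ _ _ → 0
    ; rreg = λ _ → 0#
    ; rarr = λ { zero          → padded 0# (xcoord ∘ centre ∘ D)
               ; (suc zero)    → padded 0# (ycoord ∘ centre ∘ D)
               ; (suc (suc _)) → λ _ → 0# }
    }

  -- Disk i is selected when cell i of natural array 0 holds 1.
  output : ∀ {n} → State → Subset n
  output σ = tabulate (λ i → does (narr σ 0 (toℕ i) ℕ.≟ 1))

  infix 3 _on_outputs_within_

  _on_outputs_within_ :
    ∀ {n} → Program → (Fin n → UnitDisk) → Subset n → ℕ → Set
  P on D outputs S within k =
    ∃[ t ] ∃[ τ ] (⟨ P , input D ⟩⇓[ t ] τ) × t ℕ.≤ k × output τ ≡ S

infix 4 _∈O_

_∈O_ : (ℕ → ℕ) → (ℕ → ℕ) → Set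
T ∈O f = ∃[ c ] ∃[ n₀ ] (∀ n → n₀ ℕ.≤ n → T n ℕ.≤ c ℕ.* f n)

{-# OPTIONS --safe #-}
module Submission where

-- The plane is cut greedily into horizontal strips of height 3/2: each strip
-- starts at the lowest centre not yet covered, so neither rounding nor √3 is
-- needed.  The height is chosen so that
--   * within a strip (3/2 < √3), being at distance more than 2 is transitive
--     along the x-axis: two such steps advance by at least 5/4 each;
--   * strips whose numbers differ by a positive multiple of 3 are more than 2
--     apart (3/2 > 1).
-- Order the centres by strip and then by x, and let p ≺ v when p comes before
-- v, their strip numbers agree modulo 3, and their disks are disjoint.  Then ≺
-- is transitive, so its chains are independent sets, and the union of two
-- chains induces a bipartite graph.  Conversely a side of an induced bipartite
-- subgraph falls into three chains, one for each residue, so a largest union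
-- of two disjoint chains has at least a third of the vertices of any induced
-- bipartite subgraph.  Such a union is found by dynamic programming on the
-- ends (v , b) of the two chains: for each of the O(n²) pairs the O(n²) rows
-- of the table are scanned for the best predecessor.

open import Defs
import Algebra.Properties.Ring as RingProperties
import Algebra.Properties.Semiring.Mult.TCOptimised as SemiringMult
import Algebra.Solver.Ring as RingSolver
open import Algebra.Solver.Ring.AlmostCommutativeRing using (fromCommutativeRing; _-Raw-AlmostCommutative⟶_)
open import Data.Bool using (Bool; true; false; not; _∧_)
open import Data.Fin using (Fin; zero; suc; toℕ; fromℕ<)
import Data.Fin.Properties as Fin
open import Data.Fin.Subset as Subset using (Subset; ∣_∣; inside; outside)
import Data.Fin.Subset.Properties as Subset
open import Data.Integer as ℤ using (ℤ; -[1+_])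
import Data.Integer.Properties as ℤ
open import Data.List using (List; []; _∷_; _++_; length)
open import Data.List.Properties using (length-++)
open import Data.List.Membership.Propositional using (_∈_)
open import Data.List.Membership.Propositional.Properties using (∈-∃++; ∈-++⁺ˡ; ∈-++⁺ʳ; ∈-++⁻)
open import Data.List.Relation.Unary.All as All using (All; []; _∷_)
open import Data.List.Relation.Unary.AllPairs using (AllPairs; []; _∷_)
open import Data.List.Relation.Unary.Any using (here; there)
open import Data.Maybe using (map)
open import Data.Nat as ℕ using (ℕ; zero; suc; _⊔_; s≤s; z≤n)
import Data.Nat.Properties as ℕ
open import Algebra.Properties.CommutativeSemigroup ℕ.*-commutativeSemigroup using (x∙yz≈y∙xz; interchange)
open import Data.List.Membership.DecPropositional ℕ._≟_ using (_∈?_)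
open import Data.Product using (∃-syntax; _×_; _,_; proj₁; proj₂)
open import Data.Sum using (_⊎_; inj₁; inj₂; [_,_]′)
open import Data.Unit using (⊤; tt)
open import Data.Vec using ([]; _∷_; here; there; tabulate)
open import Data.Vec.Properties using (lookup∘tabulate; lookup⇒[]=; []=⇒lookup)
open import Function using (_∘_)
open import Function.Definitions using (Injective)
open import Relation.Binary using (IsDecTotalOrder)
open import Relation.Binary.Consequences using (dec⇒weaklyDec)
open import Relation.Binary.Definitions using (tri<; tri≈; tri>)
open import Relation.Binary.PropositionalEquality as ≡ using (_≡_; _≢_; refl; cong; cong₂; sym; trans; subst; subst₂)
import Relation.Binary.Reasoning.Setoid as SetoidReasoning
open import Relation.Nullary using (¬_; does; yes; no; contradiction; Dec)
open import Relation.Nullary.Decidable using (dec-true; dec-false)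

-- Ordered fields and unit disks

-- Three classes are forced by the two conditions on the height: with only two, strips of one class
-- could be kept apart by a single strip, which would have to be at least 2 high, while transitivity
-- within a strip fails above √3. Transitivity is also what keeps the table small: whether a chain
-- can be continued depends on its end alone, so among the pairs of chains with given ends only a
-- longest one matters. The reals are an abstract ordered field, so the geometric estimates are
-- certificates: nonnegative terms whose sum the ring solver identifies with the quantity wanted or,
-- for a refutation, with `- 1#`. The running time is read off the program text: every loop guard
-- announces how often it may succeed, and a run only has to be shown to respect this.

module OrderedField (ℝ : Reals) where
  open Reals ℝ hiding (zero) renaming (refl to ≈-refl; sym to ≈-sym; trans to ≈-trans)
  open IsDecTotalOrder isDecTotalOrder public
    using (total; antisym; ≤-respˡ-≈; ≤-respʳ-≈)
    renaming (trans to ≤-trans; refl to ≤-refl; reflexive to ≤-reflexive)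
  open RingProperties ring using (-‿involutive; -‿distribˡ-*; -‿+-comm; -0#≈0#)
  open SemiringMult semiring using (×-homo-+; 1+×) renaming (_×_ to _×#_)

  -- Coefficients for the ring solver: the constants of the certificates are computed and compared
  -- in ℤ, since the abstract field has nothing to compute with. The optimised multiple makes
  -- `fromℤ ℤ.1ℤ` reduce to `1#`.
  fromℤ : ℤ → Carrier
  fromℤ (ℤ.+ n)  = n ×# 1#
  fromℤ -[1+ n ] = - (suc n ×# 1#)

  private
    open SetoidReasoning setoid

    fromℤ-⊖ : ∀ m n → fromℤ (m ℤ.⊖ n) ≈ m ×# 1# - n ×# 1#
    fromℤ-⊖ m zero = begin
      fromℤ (m ℤ.⊖ 0)   ≡⟨ ≡.cong fromℤ (ℤ.⊖-≥ {m} ℕ.z≤n) ⟩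
      m ×# 1#           ≈⟨ +-identityʳ _ ⟨
      m ×# 1# + 0#      ≈⟨ +-congˡ -0#≈0# ⟨
      m ×# 1# - 0#      ∎
    fromℤ-⊖ zero    (suc n) = ≈-sym (+-identityˡ _)
    fromℤ-⊖ (suc m) (suc n) = begin
      fromℤ (suc m ℤ.⊖ suc n)              ≡⟨ ≡.cong fromℤ (ℤ.[1+m]⊖[1+n]≡m⊖n m n) ⟩
      fromℤ (m ℤ.⊖ n)                      ≈⟨ fromℤ-⊖ m n ⟩
      a - b                                ≈⟨ +-identityˡ _ ⟨
      0# + (a - b)                         ≈⟨ +-congʳ (-‿inverseʳ 1#) ⟨
      (1# - 1#) + (a - b)                  ≈⟨ +-assoc _ _ _ ⟩
      1# + (- 1# + (a - b))                ≈⟨ +-congˡ (+-assoc _ _ _) ⟨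
      1# + ((- 1# + a) - b)                ≈⟨ +-congˡ (+-congʳ (+-comm _ _)) ⟩
      1# + ((a - 1#) - b)                  ≈⟨ +-congˡ (+-assoc _ _ _) ⟩
      1# + (a + (- 1# - b))                ≈⟨ +-assoc _ _ _ ⟨
      1# + a + (- 1# - b)                  ≈⟨ +-congˡ (-‿+-comm 1# b) ⟩
      1# + a - (1# + b)                    ≈⟨ +-cong (1+× m 1#) (-‿cong (1+× n 1#)) ⟨
      suc m ×# 1# - suc n ×# 1#            ∎
      where
      a b : Carrier
      a = m ×# 1#
      b = n ×# 1#

    fromℤ-+ : ∀ i j → fromℤ (i ℤ.+ j) ≈ fromℤ i + fromℤ j
    fromℤ-+ (ℤ.+ m)  (ℤ.+ n)  = ×-homo-+ 1# m n
    fromℤ-+ (ℤ.+ m)  -[1+ n ] = fromℤ-⊖ m (suc n)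
    fromℤ-+ -[1+ m ] (ℤ.+ n)  = ≈-trans (fromℤ-⊖ n (suc m)) (+-comm _ _)
    fromℤ-+ -[1+ m ] -[1+ n ] = begin
      - (suc (suc (m ℕ.+ n)) ×# 1#)        ≡⟨ ≡.cong (λ k → - (suc k ×# 1#)) (≡.sym (ℕ.+-suc m n)) ⟩
      - ((suc m ℕ.+ suc n) ×# 1#)          ≈⟨ -‿cong (×-homo-+ 1# (suc m) (suc n)) ⟩
      - (suc m ×# 1# + suc n ×# 1#)        ≈⟨ -‿+-comm _ _ ⟨
      - (suc m ×# 1#) - suc n ×# 1#        ∎

    fromℤ-neg : ∀ i → fromℤ (ℤ.- i) ≈ - fromℤ i
    fromℤ-neg (ℤ.+ zero)  = ≈-sym -0#≈0#
    fromℤ-neg (ℤ.+ suc n) = ≈-refl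
    fromℤ-neg -[1+ n ]    = ≈-sym (-‿involutive _)

    fromℤ-*⁺ : ∀ m j → fromℤ (ℤ.+ m ℤ.* j) ≈ m ×# 1# * fromℤ j
    fromℤ-*⁺ zero j = ≈-trans (reflexive (≡.cong fromℤ (ℤ.*-zeroˡ j))) (≈-sym (zeroˡ _))
    fromℤ-*⁺ (suc m) j = begin
      fromℤ (ℤ.+ suc m ℤ.* j)              ≡⟨ ≡.cong fromℤ (ℤ.suc-* (ℤ.+ m) j) ⟩
      fromℤ (j ℤ.+ ℤ.+ m ℤ.* j)            ≈⟨ fromℤ-+ j _ ⟩
      fromℤ j + fromℤ (ℤ.+ m ℤ.* j)        ≈⟨ +-cong (≈-sym (*-identityˡ _)) (fromℤ-*⁺ m j) ⟩
      1# * fromℤ j + m ×# 1# * fromℤ j     ≈⟨ distribʳ _ _ _ ⟨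
      (1# + m ×# 1#) * fromℤ j             ≈⟨ *-congʳ (1+× m 1#) ⟨
      suc m ×# 1# * fromℤ j                ∎

    fromℤ-* : ∀ i j → fromℤ (i ℤ.* j) ≈ fromℤ i * fromℤ j
    fromℤ-* (ℤ.+ m)  j = fromℤ-*⁺ m j
    fromℤ-* -[1+ m ] j = begin
      fromℤ (-[1+ m ] ℤ.* j)               ≡⟨ ≡.cong fromℤ (ℤ.neg-distribˡ-* (ℤ.+ suc m) j) ⟨
      fromℤ (ℤ.- (ℤ.+ suc m ℤ.* j))        ≈⟨ fromℤ-neg (ℤ.+ suc m ℤ.* j) ⟩
      - fromℤ (ℤ.+ suc m ℤ.* j)            ≈⟨ -‿cong (fromℤ-*⁺ (suc m) j) ⟩
      - (suc m ×# 1# * fromℤ j)            ≈⟨ -‿distribˡ-* _ _ ⟩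
      - (suc m ×# 1#) * fromℤ j            ∎

  private
    almostCommutativeRing = fromCommutativeRing commutativeRing

    fromℤ-morphism : ℤ.+-*-rawRing -Raw-AlmostCommutative⟶ almostCommutativeRing
    fromℤ-morphism = record
      { ⟦_⟧    = fromℤ
      ; +-homo = fromℤ-+
      ; *-homo = fromℤ-*
      ; -‿homo = fromℤ-neg
      ; 0-homo = ≈-refl
      ; 1-homo = ≈-refl
      }

  open RingSolver ℤ.+-*-rawRing almostCommutativeRing fromℤ-morphism
    (λ i j → map (reflexive ∘ ≡.cong fromℤ) (dec⇒weaklyDec ℤ._≟_ i j))
    public using (solve; _:=_; _:+_; _:*_; _:-_; :-_; con; Polynomial)

  two three four : Carrier
  two   = 1# + 1#
  three = 1# + 1# + 1#
  four  = two + two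

  x≤y⇒0≤y-x : ∀ {x y} → x ≤ y → 0# ≤ y - x
  x≤y⇒0≤y-x {x} {y} x≤y = ≤-respˡ-≈ (-‿inverseʳ x) (+-mono-≤ (- x) x≤y)

  -- With its converse this brings every inequality to the form `0# ≤ …`, where hypotheses combine
  -- by `_⊹_` and `_⊠_` and the rest is a ring identity.
  0≤y-x⇒x≤y : ∀ {x y} → 0# ≤ y - x → x ≤ y
  0≤y-x⇒x≤y {x} {y} 0≤y-x =
    ≤-respˡ-≈ (+-identityˡ x)
      (≤-respʳ-≈ (solve 2 (λ x y → y :- x :+ x := y) ≈-refl x y) (+-mono-≤ x 0≤y-x))

  ≰⇒≥ : ∀ {x y} → ¬ (x ≤ y) → y ≤ x
  ≰⇒≥ {x} {y} x≰y with total x y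
  ... | inj₁ x≤y = contradiction x≤y x≰y
  ... | inj₂ y≤x = y≤x

  infixl 6 _⊹_
  _⊹_ : ∀ {x y} → 0# ≤ x → 0# ≤ y → 0# ≤ x + y
  _⊹_ {x} {y} 0≤x 0≤y =
    ≤-trans 0≤y (≤-respˡ-≈ (+-identityˡ y) (+-mono-≤ y 0≤x))

  infixl 7 _⊠_
  _⊠_ : ∀ {x y} → 0# ≤ x → 0# ≤ y → 0# ≤ x * y
  _⊠_ = *-nonNeg

  0≤x² : ∀ x → 0# ≤ x * x
  0≤x² x with total 0# x
  ... | inj₁ 0≤x = 0≤x ⊠ 0≤x
  ... | inj₂ x≤0 = ≤-respʳ-≈ (solve 1 (λ x → (con ℤ.0ℤ :- x) :* (con ℤ.0ℤ :- x) := x :* x) ≈-refl x)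
                     (x≤y⇒0≤y-x x≤0 ⊠ x≤y⇒0≤y-x x≤0)

  0≤1 : 0# ≤ 1#
  0≤1 = ≤-respʳ-≈ (*-identityˡ 1#) (0≤x² 1#)

  0≤fromℕ : ∀ n → 0# ≤ fromℤ (ℤ.+ n)
  0≤fromℕ zero    = ≤-refl
  0≤fromℕ (suc n) = ≤-respʳ-≈ (≈-sym (1+× n 1#)) (0≤1 ⊹ 0≤fromℕ n)

  -- The contradiction in which the refuting certificates end: nonnegative terms with sum `- 1#`.
  0≰-1 : ¬ (0# ≤ - 1#)
  0≰-1 0≤-1 = 0≉1 (antisym 0≤1
    (≤-respʳ-≈ (-‿inverseˡ 1#) (≤-respˡ-≈ (+-identityˡ 1#) (+-mono-≤ 1# 0≤-1))))

  private
    :1 : ∀ {n} → Polynomial n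
    :1 = con ℤ.1ℤ

    :2 :3 :4 : ∀ {n} → Polynomial n
    :2 = :1 :+ :1
    :3 = :1 :+ :1 :+ :1
    :4 = :2 :+ :2

  -- 16 (4 − a² − b²) = (5 − 4a)(5 + 4a) + 4 (3 − 2b)(3 + 2b) + 3
  wide : ∀ {a b} → 0# ≤ a → b + b ≤ three → - b + - b ≤ three →
         ¬ (a * a + b * b ≤ four) → 0# ≤ fromℤ (ℤ.+ 4) * a - fromℤ (ℤ.+ 5)
  wide {a} {b} 0≤a 2b≤3 -2b≤3 far with total (fromℤ (ℤ.+ 5)) (fromℤ (ℤ.+ 4) * a)
  ... | inj₁ 5≤4a = x≤y⇒0≤y-x 5≤4a
  ... | inj₂ 4a≤5 = contradiction (0≤y-x⇒x≤y (≤-respʳ-≈ eq sum≥0)) far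
    where
    t = four - (a * a + b * b)
    t≤0 : 0# ≤ - t
    t≤0 = ≤-respʳ-≈ (solve 2 (λ a b → (a :* a :+ b :* b) :- :4 := :- (:4 :- (a :* a :+ b :* b))) ≈-refl a b)
            (x≤y⇒0≤y-x (≰⇒≥ far))
    -- Fifteen copies of `- t`, nonnegative because of `far`, reduce `16 t` to `t` and so spare a
    -- division.
    sum≥0 = x≤y⇒0≤y-x 4a≤5 ⊠ (0≤fromℕ 5 ⊹ 0≤fromℕ 4 ⊠ 0≤a)
          ⊹ 0≤fromℕ 4 ⊠ (x≤y⇒0≤y-x 2b≤3 ⊠ x≤y⇒0≤y-x -2b≤3)
          ⊹ 0≤fromℕ 3 ⊹ 0≤fromℕ 15 ⊠ t≤0
    eq = solve 2 (λ a b →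
           (con (ℤ.+ 5) :- con (ℤ.+ 4) :* a) :* (con (ℤ.+ 5) :+ con (ℤ.+ 4) :* a)
           :+ con (ℤ.+ 4) :* ((:3 :- (b :+ b)) :* (:3 :- (:- b :+ :- b)))
           :+ con (ℤ.+ 3) :+ con (ℤ.+ 15) :* (:- (:4 :- (a :* a :+ b :* b)))
           := :4 :- (a :* a :+ b :* b)) ≈-refl a b

  -- By `wide` each step advances by at least 5/4, so the horizontal distance s of the ends has s² ≥
  -- 25/4 > 4, whatever the vertical offset `c`. In the certificate the two excesses add up to 4s -
  -- 10, whose square plus 20 times itself is 16s² - 100, and 64 + 35 - 100 = -1.
  strip-transitive : ∀ {a a′ b b′} → 0# ≤ a → 0# ≤ a′ →
    b + b ≤ three → - b + - b ≤ three → b′ + b′ ≤ three → - b′ + - b′ ≤ three →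
    ¬ (a * a + b * b ≤ four) → ¬ (a′ * a′ + b′ * b′ ≤ four) → ∀ c →
    ¬ ((a + a′) * (a + a′) + c * c ≤ four)
  strip-transitive {a} {a′} {b} {b′} 0≤a 0≤a′ l r l′ r′ far far′ c near =
    0≰-1 (≤-respʳ-≈ eq sum≥0)
    where
    e = wide 0≤a l r far
    e′ = wide 0≤a′ l′ r′ far′
    sum≥0 = 0≤fromℕ 16 ⊠ x≤y⇒0≤y-x near ⊹ 0≤fromℕ 35 ⊹ 0≤fromℕ 16 ⊠ 0≤x² c
          ⊹ (e ⊹ e′) ⊠ (e ⊹ e′) ⊹ 0≤fromℕ 20 ⊠ (e ⊹ e′)
    :excess : ∀ {n} → Polynomial n → Polynomial n
    :excess a = con (ℤ.+ 4) :* a :- con (ℤ.+ 5)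
    eq = solve 3 (λ a a′ c →
           con (ℤ.+ 16) :* (:4 :- ((a :+ a′) :* (a :+ a′) :+ c :* c)) :+ con (ℤ.+ 35)
           :+ con (ℤ.+ 16) :* (c :* c)
           :+ (:excess a :+ :excess a′) :* (:excess a :+ :excess a′)
           :+ con (ℤ.+ 20) :* (:excess a :+ :excess a′)
           := :- :1) ≈-refl a a′ c

  -- The vertical distance is at least 3. With e = 2b - 6 one has e² + 12e + 36 = 4b², and 16 + 19 -
  -- 36 = -1.
  tall : ∀ {a b} → three + three ≤ b + b → ¬ (a * a + b * b ≤ four)
  tall {a} {b} 6≤2b near = 0≰-1 (≤-respʳ-≈ eq sum≥0)
    where
    e = x≤y⇒0≤y-x 6≤2b
    sum≥0 = 0≤fromℕ 4 ⊠ x≤y⇒0≤y-x near ⊹ 0≤fromℕ 4 ⊠ 0≤x² a ⊹ e ⊠ e ⊹ 0≤fromℕ 12 ⊠ e ⊹ 0≤fromℕ 19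
    eq = solve 2 (λ a b →
           con (ℤ.+ 4) :* (:4 :- (a :* a :+ b :* b)) :+ con (ℤ.+ 4) :* (a :* a)
           :+ (b :+ b :- (:3 :+ :3)) :* (b :+ b :- (:3 :+ :3)) :+ con (ℤ.+ 12) :* (b :+ b :- (:3 :+ :3))
           :+ con (ℤ.+ 19) := :- :1) ≈-refl a b

  half : Carrier
  half = proj₁ (inverse two two≉0)
    where
    two≉0 : ¬ (two ≈ 0#)
    two≉0 2≈0 = 0≰-1 (≤-respʳ-≈
      (≈-trans (solve 0 (:1 := :2 :- :1) ≈-refl) (≈-trans (+-congʳ 2≈0) (+-identityˡ _))) 0≤1)

  1-2half≈0 : 1# - (half + half) ≈ 0#
  1-2half≈0 = ≈-trans (+-congʳ (≈-sym (proj₁ (proj₂ (inverse two _)))))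
    (solve 1 (λ h → h :* :2 :- (h :+ h) := con ℤ.0ℤ) ≈-refl half)

  open Plane ℝ

  dist²-comm : ∀ p q → dist² p q ≈ dist² q p
  dist²-comm p q = solve 4 (λ a b c d → (a :- b) :* (a :- b) :+ (c :- d) :* (c :- d) :=
                                       (b :- a) :* (b :- a) :+ (d :- c) :* (d :- c)) ≈-refl
                     (xcoord p) (xcoord q) (ycoord p) (ycoord q)

  -- Twice the sum of the squared lengths of two vectors is |u − v|² + |u + v|².
  intersect⇒near : ∀ {d e} → Intersect d e → dist² (centre d) (centre e) ≤ four
  intersect⇒near {disk (point a b)} {disk (point c d)} (point x y , p∈d , p∈e) =
    0≤y-x⇒x≤y (≤-respʳ-≈ eq sum≥0)
    where
    u = a - x + (c - x)
    v = b - y + (d - y)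
    0≤2 = 0≤1 ⊹ 0≤1
    sum≥0 = 0≤2 ⊠ x≤y⇒0≤y-x p∈d ⊹ 0≤2 ⊠ x≤y⇒0≤y-x p∈e ⊹ 0≤x² u ⊹ 0≤x² v
    eq = solve 6 (λ a b c d x y →
           :2 :* (:1 :- ((a :- x) :* (a :- x) :+ (b :- y) :* (b :- y)))
           :+ :2 :* (:1 :- ((c :- x) :* (c :- x) :+ (d :- y) :* (d :- y)))
           :+ (a :- x :+ (c :- x)) :* (a :- x :+ (c :- x))
           :+ (b :- y :+ (d :- y)) :* (b :- y :+ (d :- y))
           := :4 :- ((a :- c) :* (a :- c) :+ (b :- d) :* (b :- d))) ≈-refl a b c d x y

  -- The midpoint of the centres is a common point: its squared distance from either centre is a
  -- quarter of theirs. Membership in the second disk is the same estimate with the disks exchanged.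
  near⇒intersect : ∀ {d e} → dist² (centre d) (centre e) ≤ four → Intersect d e
  near⇒intersect {disk (point a b)} {disk (point c d)} near =
    point (mid a c) (mid b d) ,
    inUnit a b c d near ,
    ≤-respˡ-≈ (+-cong (*-cong (mid-comm a c) (mid-comm a c)) (*-cong (mid-comm b d) (mid-comm b d)))
      (inUnit c d a b (≤-respˡ-≈ (dist²-comm (point a b) (point c d)) near))
    where
    mid : Carrier → Carrier → Carrier
    mid x y = half * (x + y)

    mid-comm : ∀ {z} x y → z - mid y x ≈ z - mid x y
    mid-comm x y = +-congˡ (-‿cong (*-congˡ (+-comm y x)))

    x-mid : ∀ x y → x - mid x y ≈ half * (x - y)
    x-mid x y = ≈-trans
      (solve 3 (λ x y h → x :- h :* (x :+ y) := (:1 :- (h :+ h)) :* x :+ h :* (x :- y)) ≈-refl x y half)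
      (≈-trans (+-congʳ (≈-trans (*-congʳ 1-2half≈0) (zeroˡ x))) (+-identityˡ _))

    -- What is known of `half` is `1-2half≈0`, so the left side is rewritten as the square of 1 - (1
    -- - 2 `half`).
    1≈4half² : four * (half * half) ≈ 1#
    1≈4half² = ≈-trans
      (solve 1 (λ h → :4 :* (h :* h) := (:1 :- (:1 :- (h :+ h))) :* (:1 :- (:1 :- (h :+ h)))) ≈-refl half)
      (≈-trans (*-cong one one) (*-identityˡ 1#))
      where
      one : 1# - (1# - (half + half)) ≈ 1#
      one = ≈-trans (+-congˡ (≈-trans (-‿cong 1-2half≈0) -0#≈0#)) (+-identityʳ 1#)

    inUnit : ∀ a b c d → (a - c) * (a - c) + (b - d) * (b - d) ≤ four →
             (a - mid a c) * (a - mid a c) + (b - mid b d) * (b - mid b d) ≤ 1#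
    inUnit a b c d near = ≤-respˡ-≈
      (≈-sym (+-cong (*-cong (x-mid a c) (x-mid a c)) (*-cong (x-mid b d) (x-mid b d))))
      (0≤y-x⇒x≤y (≤-respʳ-≈
        (≈-trans
          (solve 3 (λ h u v → h :* h :* (:4 :- (u :* u :+ v :* v)) :=
                              :4 :* (h :* h) :- (h :* u :* (h :* u) :+ h :* v :* (h :* v)))
            ≈-refl half (a - c) (b - d))
          (+-congʳ 1≈4half²))
        (0≤x² half ⊠ x≤y⇒0≤y-x near)))

-- Program logic

update-≡ : ∀ {A : Set} (f : ℕ → A) k v → update f k v k ≡ v
update-≡ f k v with k ℕ.≟ k
... | yes _  = refl
... | no k≢k = contradiction refl k≢k

update-≢ : ∀ {A : Set} (f : ℕ → A) {k j} v → j ≢ k → update f k v j ≡ f j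
update-≢ f {k} {j} v j≢k with j ℕ.≟ k
... | yes j≡k = contradiction j≡k j≢k
... | no _    = refl

for_below_loop_ : Name → Name → Program → Program
for i below e loop P =
  i ≔ⁿ lit 0 ⨾ while notᵇ (reg e ≤ⁿ reg i) loop (P ⨾ i ≔ⁿ reg i ⊕ lit 1)

-- A loop whose guard compares with register 0 runs at most 1 + n times, and
-- any other loop at most (1 + n)² times.
guardDegree : BExp → ℕ
guardDegree (notᵇ (reg 0 ≤ⁿ _)) = 1
guardDegree _                   = 2

-- Branches are added, and a loop is charged the number of rounds that its guard announces plus the
-- final failing test. For an arbitrary program this need not bound anything; `for-rule` is where a
-- run is shown to keep to it.
bound : ℕ → Program → ℕ
bound n skip                 = 1
bound n (_ ≔ⁿ e)             = 1 ℕ.+ costⁿ e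
bound n (_ ≔ʳ e)             = 1 ℕ.+ costʳ e
bound n (_ [ i ]≔ⁿ e)        = 1 ℕ.+ (costⁿ i ℕ.+ costⁿ e)
bound n (_ [ i ]≔ʳ e)        = 1 ℕ.+ (costⁿ i ℕ.+ costʳ e)
bound n (P ⨾ Q)              = bound n P ℕ.+ bound n Q
bound n (if b then P else Q) = 1 ℕ.+ (costᵇ b ℕ.+ (bound n P ℕ.+ bound n Q))
bound n (while b loop P)     =
  suc n ℕ.^ guardDegree b ℕ.* (1 ℕ.+ (costᵇ b ℕ.+ bound n P)) ℕ.+ (1 ℕ.+ costᵇ b)

degree : Program → ℕ
degree (P ⨾ Q)              = degree P ⊔ degree Q
degree (if b then P else Q) = degree P ⊔ degree Q
degree (while b loop P)     = guardDegree b ℕ.+ degree P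
degree _                    = 0

private
  ^-inflate : ∀ n d e c → d ℕ.≤ e → c ℕ.* suc n ℕ.^ d ℕ.≤ c ℕ.* suc n ℕ.^ e
  ^-inflate n d e c d≤e = ℕ.*-monoʳ-≤ c (ℕ.^-monoʳ-≤ (suc n) d≤e)

  const-bound : ∀ n c d → c ℕ.≤ c ℕ.* suc n ℕ.^ d
  const-bound n c d = ℕ.m≤m*n c (suc n ℕ.^ d) {{ℕ.m^n≢0 (suc n) d}}

-- Powers of `suc n`, unlike those of `n`, are never zero, so constants and lower powers are
-- absorbed by higher ones even at `n = 0`.
coefficient : ∀ P → ∃[ c ] (∀ n → bound n P ℕ.≤ c ℕ.* suc n ℕ.^ degree P)
coefficient skip          = 1 , λ n → const-bound n _ 0
coefficient (_ ≔ⁿ e)      = 1 ℕ.+ costⁿ e , λ n → const-bound n _ 0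
coefficient (_ ≔ʳ e)      = 1 ℕ.+ costʳ e , λ n → const-bound n _ 0
coefficient (_ [ i ]≔ⁿ e) = 1 ℕ.+ (costⁿ i ℕ.+ costⁿ e) , λ n → const-bound n _ 0
coefficient (_ [ i ]≔ʳ e) = 1 ℕ.+ (costⁿ i ℕ.+ costʳ e) , λ n → const-bound n _ 0
coefficient (P ⨾ Q) with coefficient P | coefficient Q
... | c , p | d , q = c ℕ.+ d , λ n → begin
  bound n P ℕ.+ bound n Q
    ≤⟨ ℕ.+-mono-≤ (p n) (q n) ⟩
  c ℕ.* suc n ℕ.^ degree P ℕ.+ d ℕ.* suc n ℕ.^ degree Q
    ≤⟨ ℕ.+-mono-≤ (^-inflate n (degree P) _ c (ℕ.m≤m⊔n (degree P) (degree Q)))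
                      (^-inflate n (degree Q) _ d (ℕ.m≤n⊔m (degree P) (degree Q))) ⟩
  c ℕ.* suc n ℕ.^ (degree P ⊔ degree Q) ℕ.+ d ℕ.* suc n ℕ.^ (degree P ⊔ degree Q)
    ≡⟨ ℕ.*-distribʳ-+ _ c d ⟨
  (c ℕ.+ d) ℕ.* suc n ℕ.^ (degree P ⊔ degree Q) ∎
  where open ℕ.≤-Reasoning
coefficient (if b then P else Q) with coefficient (P ⨾ Q)
... | c , p = suc (costᵇ b) ℕ.+ c , λ n → begin
  suc (costᵇ b) ℕ.+ (bound n P ℕ.+ bound n Q)
    ≤⟨ ℕ.+-mono-≤ (const-bound n (suc (costᵇ b)) (degree P ⊔ degree Q)) (p n) ⟩
  suc (costᵇ b) ℕ.* suc n ℕ.^ (degree P ⊔ degree Q) ℕ.+ c ℕ.* suc n ℕ.^ (degree P ⊔ degree Q)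
    ≡⟨ ℕ.*-distribʳ-+ _ (suc (costᵇ b)) c ⟨
  (suc (costᵇ b) ℕ.+ c) ℕ.* suc n ℕ.^ (degree P ⊔ degree Q) ∎
  where open ℕ.≤-Reasoning
coefficient (while b loop P) with coefficient P
... | c , p = k ℕ.+ c ℕ.+ k , λ n → begin
  suc n ℕ.^ g ℕ.* (k ℕ.+ bound n P) ℕ.+ k
    ≤⟨ ℕ.+-mono-≤ (ℕ.*-monoʳ-≤ (suc n ℕ.^ g) (ℕ.+-mono-≤ (const-bound n k d) (p n)))
                 (const-bound n k (g ℕ.+ d)) ⟩
  suc n ℕ.^ g ℕ.* (k ℕ.* suc n ℕ.^ d ℕ.+ c ℕ.* suc n ℕ.^ d) ℕ.+ k ℕ.* suc n ℕ.^ (g ℕ.+ d)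
    ≡⟨ cong (λ x → suc n ℕ.^ g ℕ.* x ℕ.+ k ℕ.* suc n ℕ.^ (g ℕ.+ d)) (ℕ.*-distribʳ-+ (suc n ℕ.^ d) k c) ⟨
  suc n ℕ.^ g ℕ.* ((k ℕ.+ c) ℕ.* suc n ℕ.^ d) ℕ.+ k ℕ.* suc n ℕ.^ (g ℕ.+ d)
    ≡⟨ cong (ℕ._+ k ℕ.* suc n ℕ.^ (g ℕ.+ d)) (x∙yz≈y∙xz (suc n ℕ.^ g) (k ℕ.+ c) (suc n ℕ.^ d)) ⟩
  (k ℕ.+ c) ℕ.* (suc n ℕ.^ g ℕ.* suc n ℕ.^ d) ℕ.+ k ℕ.* suc n ℕ.^ (g ℕ.+ d)
    ≡⟨ cong (λ x → (k ℕ.+ c) ℕ.* x ℕ.+ k ℕ.* suc n ℕ.^ (g ℕ.+ d)) (ℕ.^-distribˡ-+-* (suc n) g d) ⟨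
  (k ℕ.+ c) ℕ.* suc n ℕ.^ (g ℕ.+ d) ℕ.+ k ℕ.* suc n ℕ.^ (g ℕ.+ d)
    ≡⟨ ℕ.*-distribʳ-+ _ (k ℕ.+ c) k ⟨
  (k ℕ.+ c ℕ.+ k) ℕ.* suc n ℕ.^ (g ℕ.+ d) ∎
  where
  open ℕ.≤-Reasoning
  g = guardDegree b
  d = degree P
  k = suc (costᵇ b)

-- From `n = 1` on, `suc n` is at most `2 * n`; the price is the factor `2 ^ degree P`.
bound∈O : ∀ P → (λ n → bound n P) ∈O (λ n → n ℕ.^ degree P)
bound∈O P with coefficient P
... | c , p = c ℕ.* 2 ℕ.^ degree P , 1 , λ n 1≤n → begin
  bound n P                                 ≤⟨ p n ⟩
  c ℕ.* suc n ℕ.^ degree P                  ≤⟨ ℕ.*-monoʳ-≤ c (ℕ.^-monoˡ-≤ (degree P) (double 1≤n)) ⟩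
  c ℕ.* (2 ℕ.* n) ℕ.^ degree P              ≡⟨ cong (c ℕ.*_) (^-distribʳ-* (degree P) 2 n) ⟩
  c ℕ.* (2 ℕ.^ degree P ℕ.* n ℕ.^ degree P) ≡⟨ ℕ.*-assoc c _ _ ⟨
  c ℕ.* 2 ℕ.^ degree P ℕ.* n ℕ.^ degree P   ∎
  where
  open ℕ.≤-Reasoning
  ^-distribʳ-* : ∀ d x y → (x ℕ.* y) ℕ.^ d ≡ x ℕ.^ d ℕ.* y ℕ.^ d
  ^-distribʳ-* zero    x y = refl
  ^-distribʳ-* (suc d) x y = trans (cong (x ℕ.* y ℕ.*_) (^-distribʳ-* d x y))
                                   (interchange x y (x ℕ.^ d) (y ℕ.^ d))
  double : ∀ {n} → 1 ℕ.≤ n → suc n ℕ.≤ 2 ℕ.* n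
  double {n} 1≤n = ℕ.+-mono-≤ 1≤n (ℕ.m≤m+n n 0)

n≤[1+n]^1 : ∀ n → n ℕ.≤ suc n ℕ.^ 1
n≤[1+n]^1 n = ℕ.≤-trans (ℕ.n≤1+n n) (ℕ.≤-reflexive (sym (ℕ.^-identityʳ (suc n))))

-- Total correctness within a time bound

module ProgramLogic (ℝ : Reals) where
  open RealRAM ℝ

  record Terminates (n : ℕ) (P : Program) (Q : State → Set) (σ : State) : Set where
    constructor halts
    field
      execution : ∃[ t ] ∃[ τ ] (⟨ P , σ ⟩⇓[ t ] τ) × t ℕ.≤ bound n P × Q τ

  module _ {n : ℕ} where

    skip-rule : ∀ {Q σ} → Q σ → Terminates n skip Q σ
    skip-rule q = halts (_ , _ , ⇓skip , ℕ.≤-refl , q)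

    ≔ⁿ-rule : ∀ {Q σ v e} → Q (record σ { nreg = update (nreg σ) v (evalⁿ e σ) }) →
      Terminates n (v ≔ⁿ e) Q σ
    ≔ⁿ-rule q = halts (_ , _ , ⇓≔ⁿ , ℕ.≤-refl , q)

    []≔ⁿ-rule : ∀ {Q σ a i e} →
      Q (record σ { narr = update (narr σ) a (update (narr σ a) (evalⁿ i σ) (evalⁿ e σ)) }) →
      Terminates n (a [ i ]≔ⁿ e) Q σ
    []≔ⁿ-rule q = halts (_ , _ , ⇓[]≔ⁿ , ℕ.≤-refl , q)

    ⨾-rule : ∀ {P Q R S σ} → Terminates n P R σ →
      (∀ τ → R τ → Terminates n Q S τ) → Terminates n (P ⨾ Q) S σ
    ⨾-rule (halts (s , τ , p , s≤ , r)) f with f τ r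
    ... | halts (t , υ , q , t≤ , post) = halts (_ , υ , ⇓⨾ p q , ℕ.+-mono-≤ s≤ t≤ , post)

    -- Symbolic execution: the rest is verified from the updated state itself, so no intermediate
    -- assertion has to be stated.
    ≔ⁿ⨾-rule : ∀ {P Q σ v e} →
      Terminates n P Q (record σ { nreg = update (nreg σ) v (evalⁿ e σ) }) →
      Terminates n (v ≔ⁿ e ⨾ P) Q σ
    ≔ⁿ⨾-rule (halts (s , τ , p , s≤ , q)) = halts (_ , τ , ⇓⨾ ⇓≔ⁿ p , ℕ.+-monoʳ-≤ _ s≤ , q)

    []≔ⁿ⨾-rule : ∀ {P Q σ a i e} →
      Terminates n P Q (record σ { narr = update (narr σ) a (update (narr σ a) (evalⁿ i σ) (evalⁿ e σ)) }) →
      Terminates n (a [ i ]≔ⁿ e ⨾ P) Q σ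
    []≔ⁿ⨾-rule (halts (s , τ , p , s≤ , q)) = halts (_ , τ , ⇓⨾ ⇓[]≔ⁿ p , ℕ.+-monoʳ-≤ _ s≤ , q)

    if-rule : ∀ {P Q R σ b} →
      (evalᵇ b σ ≡ true → Terminates n P R σ) →
      (evalᵇ b σ ≡ false → Terminates n Q R σ) →
      Terminates n (if b then P else Q) R σ
    if-rule {P} {Q} {R} {σ} {b} p q with evalᵇ b σ in eq
    ... | true  with p refl
    ...   | halts (t , τ , r , t≤ , post) =
      halts (_ , τ , ⇓then eq r , s≤s (ℕ.+-monoʳ-≤ (costᵇ b) (ℕ.m≤n⇒m≤n+o _ t≤)) , post)
    if-rule {P} {Q} {R} {σ} {b} p q | false with q refl
    ...   | halts (t , τ , r , t≤ , post) =
      halts (_ , τ , ⇓else eq r , s≤s (ℕ.+-monoʳ-≤ (costᵇ b) (ℕ.m≤n⇒m≤o+n _ t≤)) , post)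

    consequence : ∀ {P Q R σ} → (∀ {τ} → Q τ → R τ) → Terminates n P Q σ → Terminates n P R σ
    consequence f (halts (t , τ , p , t≤ , q)) = halts (t , τ , p , t≤ , f q)

    setⁿ : Name → ℕ → State → State
    setⁿ v k σ = record σ { nreg = update (nreg σ) v k }

    -- The bound on `m` ties the actual number of rounds to the number that `bound` charges for this
    -- guard. `Inv` must survive changes of the counter, which the loop itself resets and
    -- increments; for concrete register names this holds by computation.
    for-rule : ∀ {P σ i e} m (Inv : ℕ → State → Set) →
      e ≢ i → nreg σ e ≡ m →
      m ℕ.≤ suc n ℕ.^ guardDegree (notᵇ (reg e ≤ⁿ reg i)) →
      (∀ k τ x → Inv k τ → Inv k (setⁿ i x τ)) →
      Inv 0 σ →
      (∀ k τ → k ℕ.< m → nreg τ i ≡ k → nreg τ e ≡ m → Inv k τ →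
        Terminates n P (λ υ → nreg υ i ≡ k × nreg υ e ≡ m × Inv (suc k) υ) τ) →
      Terminates n (for i below e loop P) (λ τ → nreg τ e ≡ m × Inv m τ) σ
    for-rule {P} {σ} {i} {e} m Inv e≢i σe≡m m≤ stable base step =
      ≔ⁿ⨾-rule (finish (iterate m 0 (setⁿ i 0 σ) (ℕ.+-identityʳ m) (update-≡ (nreg σ) i 0)
        (trans (update-≢ (nreg σ) 0 e≢i) σe≡m) (stable 0 σ 0 base)))
      where
      guard : BExp
      guard = notᵇ (reg e ≤ⁿ reg i)
      body : Program
      body = P ⨾ i ≔ⁿ reg i ⊕ lit 1
      Post : State → Set
      Post τ = nreg τ e ≡ m × Inv m τ
      unit : ℕ
      unit = 1 ℕ.+ (costᵇ guard ℕ.+ bound n body)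

      enter : ∀ τ {k} → nreg τ i ≡ k → nreg τ e ≡ m → k ℕ.< m → evalᵇ guard τ ≡ true
      enter τ refl refl k<m = cong not (dec-false (nreg τ e ℕ.≤? nreg τ i) (ℕ.<⇒≱ k<m))
      leave : ∀ τ {k} → nreg τ i ≡ k → nreg τ e ≡ m → m ℕ.≤ k → evalᵇ guard τ ≡ false
      leave τ refl refl m≤k = cong not (dec-true (nreg τ e ℕ.≤? nreg τ i) m≤k)

      -- Recursion on the number `r` of rounds still to come, which makes the time `r` rounds plus
      -- the failing test.
      iterate : ∀ r k τ → r ℕ.+ k ≡ m → nreg τ i ≡ k → nreg τ e ≡ m → Inv k τ →
        ∃[ t ] ∃[ υ ] (⟨ while guard loop body , τ ⟩⇓[ t ] υ) ×
          t ℕ.≤ r ℕ.* unit ℕ.+ (1 ℕ.+ costᵇ guard) × Post υ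
      iterate zero k τ refl τi≡k τe≡m inv =
        _ , τ , ⇓exit (leave τ τi≡k τe≡m ℕ.≤-refl) , ℕ.≤-refl , τe≡m , inv
      iterate (suc r) k τ eq τi≡k τe≡m inv
        with step k τ (ℕ.≤-trans (s≤s (ℕ.m≤n+m k r)) (ℕ.≤-reflexive eq)) τi≡k τe≡m inv
      ... | halts (s , υ , p , s≤ , refl , υe≡m , inv′)
        with iterate r (suc (nreg υ i)) (setⁿ i (nreg υ i ℕ.+ 1) υ) (trans (ℕ.+-suc r _) eq)
               (trans (update-≡ (nreg υ) i _) (ℕ.+-comm _ 1))
               (trans (update-≢ (nreg υ) _ e≢i) υe≡m) (stable _ υ _ inv′)
      ...   | t , φ , q , t≤ , post =
        _ , φ ,
        ⇓loop (enter τ τi≡k τe≡m (ℕ.≤-trans (s≤s (ℕ.m≤n+m k r)) (ℕ.≤-reflexive eq))) (⇓⨾ p ⇓≔ⁿ) q ,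
        (begin
          1 ℕ.+ (costᵇ guard ℕ.+ (s ℕ.+ _ ℕ.+ t))
            ≤⟨ s≤s (ℕ.+-monoʳ-≤ (costᵇ guard) (ℕ.+-mono-≤ (ℕ.+-monoˡ-≤ _ s≤) t≤)) ⟩
          1 ℕ.+ (costᵇ guard ℕ.+ (bound n body ℕ.+ (r ℕ.* unit ℕ.+ (1 ℕ.+ costᵇ guard))))
            ≡⟨ cong suc (ℕ.+-assoc (costᵇ guard) (bound n body) _) ⟨
          unit ℕ.+ (r ℕ.* unit ℕ.+ (1 ℕ.+ costᵇ guard))
            ≡⟨ ℕ.+-assoc unit (r ℕ.* unit) _ ⟨
          suc r ℕ.* unit ℕ.+ (1 ℕ.+ costᵇ guard) ∎) ,
        post
        where open ℕ.≤-Reasoning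

      finish : ∀ {τ} →
        ∃[ t ] ∃[ υ ] (⟨ while guard loop body , τ ⟩⇓[ t ] υ) ×
          t ℕ.≤ m ℕ.* unit ℕ.+ (1 ℕ.+ costᵇ guard) × Post υ →
        Terminates n (while guard loop body) Post τ
      finish (t , υ , p , t≤ , post) =
        halts (t , υ , p , ℕ.≤-trans t≤ (ℕ.+-monoˡ-≤ _ (ℕ.*-monoˡ-≤ unit m≤)) , post)

-- The program

numDisks outer inner scan strip class start count old bestSize bestPred best steps : Name
numDisks = 0
outer    = 1
inner    = 2
scan     = 3
strip    = 4
class    = 5
start    = 6
count    = 7
old      = 8
bestSize = 9
bestPred = 10
best     = 11
steps    = 12

chosen order stripOf classOf last other size pred : Name
chosen  = 0
order   = 1
stripOf = 2
classOf = 3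
last    = 4
other   = 5
size    = 6
pred    = 7

xs ys : Name
xs = 0
ys = 1

infixr 3 _orᵇ_
_orᵇ_ : BExp → BExp → BExp
b orᵇ c = notᵇ (notᵇ b andᵇ notᵇ c)

-- Heights are doubled to make the strip height 3/2 an integer.
double : NExp → RExp
double u = arr ys u ⊕ arr ys u

initialise : Program
initialise = for outer below numDisks loop (order [ reg outer ]≔ⁿ reg outer)

-- `scan` is free during sorting and serves as the temporary.
swap : Program
swap = scan ≔ⁿ arr order (reg outer) ⨾
       order [ reg outer ]≔ⁿ arr order (reg inner) ⨾
       order [ reg inner ]≔ⁿ reg scan

-- Exchange sort. Loops always start at 0, so the inner one also meets the positions before `outer`,
-- which the guard passes over. Quadratic time is well below the cost of the table.
sort : BExp → Program
sort le =
  for outer below numDisks loop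
    for inner below numDisks loop
      if ((reg outer ≤ⁿ reg inner) andᵇ notᵇ le) then swap else skip

byHeight : BExp
byHeight = double (arr order (reg outer)) ≤ʳ double (arr order (reg inner))

byStrip : BExp
byStrip = notᵇ (st inner ≤ⁿ st outer)
     orᵇ ((st inner =ⁿ st outer) andᵇ (x outer ≤ʳ x inner))
  where
  st : Name → NExp
  st i = arr stripOf (arr order (reg i))
  x : Name → RExp
  x i = arr xs (arr order (reg i))

fitsStrip : BExp
fitsStrip = double (arr order (reg outer)) ≤ʳ (double (reg start) ⊕ (𝟙 ⊕ 𝟙 ⊕ 𝟙))

nextStrip : Program
nextStrip = strip ≔ⁿ reg strip ⊕ lit 1 ⨾
            start ≔ⁿ arr order (reg outer) ⨾
            -- A cyclic counter, because the machine has no remainder operation.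
            (if (reg class =ⁿ lit 2) then (class ≔ⁿ lit 0) else (class ≔ⁿ reg class ⊕ lit 1))

record-strip : Program
record-strip = stripOf [ arr order (reg outer) ]≔ⁿ reg strip ⨾
               classOf [ arr order (reg outer) ]≔ⁿ reg class

-- Strips of height 3/2, the next one starting at the lowest disk centre not
-- yet covered; the class of a strip is its number modulo 3.
assignStrips : Program
assignStrips =
  strip ≔ⁿ lit 0 ⨾ class ≔ⁿ lit 0 ⨾ start ≔ⁿ arr order (lit 0) ⨾
  for outer below numDisks loop
    ((if fitsStrip then skip else nextStrip) ⨾ record-strip)

-- The constant is bracketed like `four`, so that the test evaluates definitionally to `nearᵇ`.
near : NExp → NExp → BExp
near u w = (dx ⊛ dx ⊕ dy ⊛ dy) ≤ʳ (𝟙 ⊕ 𝟙 ⊕ (𝟙 ⊕ 𝟙))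
  where
  dx dy : RExp
  dx = arr xs u ⊖ arr xs w
  dy = arr ys u ⊖ arr ys w

-- Whether a chain that ends in p can be continued by the position in
-- register outer: 0 is the end of the empty chain, suc p that of a chain
-- with last position p.
continues : NExp → BExp
continues p = (p =ⁿ lit 0) orᵇ
  ((arr classOf u =ⁿ arr classOf w) andᵇ notᵇ (near u w))
  where
  u w : NExp
  -- At `p = 0` the truncated difference harmlessly reads cell 0: the first disjunct already holds.
  u = arr order (p ⊖ lit 1)
  w = arr order (reg outer)

-- There are two ways to reach the ends `outer` and `inner`: the new position continues the chain
-- with the later end and the other end stays, or it continues the other chain and the former later
-- end becomes the other one.
candidate : BExp
candidate =
  ((arr other (reg scan) =ⁿ reg inner) andᵇ continues (arr last (reg scan))) orᵇ
  ((arr last (reg scan) =ⁿ reg inner) andᵇ continues (arr other (reg scan)))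

-- `bestSize` counts the new position, so `≤ⁿ` against the size of the unextended pair asks for a
-- strict improvement, and 0 is free to mean that no predecessor was found.
improve : Program
improve =
  if (candidate andᵇ (reg bestSize ≤ⁿ arr size (reg scan)))
  then (bestSize ≔ⁿ arr size (reg scan) ⊕ lit 1 ⨾ bestPred ≔ⁿ reg scan)
  else skip

append : Program
append =
  last  [ reg count ]≔ⁿ reg outer ⊕ lit 1 ⨾
  other [ reg count ]≔ⁿ reg inner ⨾
  size  [ reg count ]≔ⁿ reg bestSize ⨾
  pred  [ reg count ]≔ⁿ reg bestPred ⨾
  (if (reg bestSize ≤ⁿ arr size (reg best)) then skip else (best ≔ⁿ reg count)) ⨾
  count ≔ⁿ reg count ⊕ lit 1

-- Only rows made before the current value of `outer` can be predecessors, as the later ones already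
-- end in this position. Each pair of `outer` and `inner` adds at most one row, which keeps their
-- number quadratic.
search : Program
search =
  bestSize ≔ⁿ lit 0 ⨾
  (for scan below old loop improve) ⨾
  (if (reg bestSize ≤ⁿ lit 0) then skip else append)

-- Row s of the table (last, other, size, pred) stands for a pair of disjoint
-- chains of positions with ends last s and other s, the former being the
-- later one; row 0 is the pair of empty chains.
buildTable : Program
buildTable =
  count ≔ⁿ lit 1 ⨾ best ≔ⁿ lit 0 ⨾
  for outer below numDisks loop
    (old ≔ⁿ reg count ⨾ for inner below numDisks loop search)

-- The position added when a row was made is its `last`, whichever chain it went to, so following
-- `pred` lists the union of both chains.
extract : Program
extract =
  steps ≔ⁿ arr size (reg best) ⨾
  for outer below steps loop
    (chosen [ arr order (arr last (reg best) ⊖ lit 1) ]≔ⁿ lit 1 ⨾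
     best ≔ⁿ arr pred (reg best))

program : Program
program = initialise ⨾ sort byHeight ⨾ assignStrips ⨾ sort byStrip ⨾ buildTable ⨾ extract

-- Transpositions, permutations and exchange sort

transpose : ℕ → ℕ → ℕ → ℕ
transpose i j q with q ℕ.≟ j
... | yes _ = i
... | no _ with q ℕ.≟ i
...   | yes _ = j
...   | no _  = q

transpose-fixes : ∀ i j {q} → q ≢ i → q ≢ j → transpose i j q ≡ q
transpose-fixes i j {q} q≢i q≢j with q ℕ.≟ j
... | yes q≡j = contradiction q≡j q≢j
... | no _ with q ℕ.≟ i
...   | yes q≡i = contradiction q≡i q≢i
...   | no _    = refl

transpose-j : ∀ i j → transpose i j j ≡ i
transpose-j i j with j ℕ.≟ j
... | yes _  = refl
... | no j≢j = contradiction refl j≢j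

transpose-i : ∀ i j → transpose i j i ≡ j
transpose-i i j with i ℕ.≟ j
... | yes refl = refl
... | no _ with i ℕ.≟ i
...   | yes _  = refl
...   | no i≢i = contradiction refl i≢i

transpose-involutive : ∀ i j q → transpose i j (transpose i j q) ≡ q
transpose-involutive i j q with q ℕ.≟ j
... | yes refl = transpose-i i q
... | no q≢j with q ℕ.≟ i
...   | yes refl = transpose-j q j
...   | no q≢i   = transpose-fixes i j q≢i q≢j

transpose-< : ∀ {i j q n} → i ℕ.< n → j ℕ.< n → q ℕ.< n → transpose i j q ℕ.< n
transpose-< {i} {j} {q} i<n j<n q<n with q ℕ.≟ j
... | yes _ = i<n
... | no _ with q ℕ.≟ i
...   | yes _ = j<n
...   | no _  = q<n

swapped : (ℕ → ℕ) → ℕ → ℕ → ℕ → ℕ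
swapped f i j = update (update f i (f j)) j (f i)

-- Each case is a computation because both sides test `j` before `i`.
swapped-transpose : ∀ f i j q → swapped f i j q ≡ f (transpose i j q)
swapped-transpose f i j q with q ℕ.≟ j
... | yes _ = refl
... | no _ with q ℕ.≟ i
...   | yes _ = refl
...   | no _  = refl

record Permutation (n : ℕ) (f : ℕ → ℕ) : Set where
  field
    bounded    : ∀ {q} → q ℕ.< n → f q ℕ.< n
    injective  : ∀ {p q} → p ℕ.< n → q ℕ.< n → f p ≡ f q → p ≡ q
    surjective : ∀ {u} → u ℕ.< n → ∃[ q ] q ℕ.< n × f q ≡ u

swapped-permutation : ∀ {n f i j} → i ℕ.< n → j ℕ.< n →
  Permutation n f → Permutation n (swapped f i j)
swapped-permutation {n} {f} {i} {j} i<n j<n perm = record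
  { bounded = λ {q} q<n → subst (ℕ._< n) (sym (swapped-transpose f i j q)) (bounded (transpose-< i<n j<n q<n))
  ; injective = λ {p} {q} p<n q<n eq →
      trans (sym (transpose-involutive i j p)) (trans
        (cong (transpose i j) (injective (transpose-< i<n j<n p<n) (transpose-< i<n j<n q<n)
          (trans (sym (swapped-transpose f i j p)) (trans eq (swapped-transpose f i j q)))))
        (transpose-involutive i j q))
  ; surjective = λ {u} u<n → let q , q<n , fq≡u = surjective u<n in
      transpose i j q , transpose-< i<n j<n q<n ,
      trans (swapped-transpose f i j (transpose i j q)) (trans (cong f (transpose-involutive i j q)) fq≡u)
  }
  where open Permutation perm

∧-true : ∀ {x y} → x ∧ y ≡ true → x ≡ true × y ≡ true
∧-true {true} {true} refl = refl , refl

∧-false : ∀ {x y} → x ∧ y ≡ false → x ≡ true → y ≡ false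
∧-false eq refl = eq

not-true : ∀ {x} → not x ≡ true → x ≡ false
not-true {false} _ = refl

not-false : ∀ {x} → not x ≡ false → x ≡ true
not-false {true} _ = refl

does-true : ∀ {A : Set} (a? : Dec A) → does a? ≡ true → A
does-true (yes a) _ = a

does-false : ∀ {A : Set} (a? : Dec A) → does a? ≡ false → ¬ A
does-false (no ¬a) _ = ¬a

module Sorting (ℝ : Reals) (n : ℕ) where
  open RealRAM ℝ
  open ProgramLogic ℝ

  module _
    (_⊑_ : ℕ → ℕ → Bool)
    (⊑-total : ∀ {u w} → u ⊑ w ≡ false → w ⊑ u ≡ true)
    (⊑-trans : ∀ {u v w} → u ⊑ v ≡ true → v ⊑ w ≡ true → u ⊑ w ≡ true)
    where

    Sorted : ℕ → (ℕ → ℕ) → Set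
    Sorted i f = ∀ p q → p ℕ.< i → p ℕ.< q → q ℕ.< n → f p ⊑ f q ≡ true

    -- Vacuous for `j ≤ i`, which accounts for the rounds of the inner loop that the guard passes
    -- over.
    LeastUpTo : ℕ → ℕ → (ℕ → ℕ) → Set
    LeastUpTo i j f = ∀ q → i ℕ.≤ q → q ℕ.< j → f i ⊑ f q ≡ true

    ⊑-refl : ∀ {u} → u ⊑ u ≡ true
    ⊑-refl {u} with u ⊑ u in eq
    ... | true  = refl
    ... | false = trans (sym eq) (⊑-total eq)

    swapped-sorted : ∀ {f i j} → i ℕ.≤ j → j ℕ.< n → Sorted i f → Sorted i (swapped f i j)
    swapped-sorted {f} {i} {j} i≤j j<n sorted p q p<i p<q q<n =
      subst (λ z → z ⊑ swapped f i j q ≡ true) (sym (trans (swapped-transpose f i j p)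
        (cong f (transpose-fixes i j (ℕ.<⇒≢ p<i) (ℕ.<⇒≢ (ℕ.<-≤-trans p<i i≤j))))))
        below
      where
      below : f p ⊑ swapped f i j q ≡ true
      below with q ℕ.≟ j
      ... | yes refl = sorted p i p<i p<i (ℕ.≤-<-trans i≤j j<n)
      ... | no _ with q ℕ.≟ i
      ...   | yes refl = sorted p j p<i (ℕ.<-≤-trans p<i i≤j) j<n
      ...   | no _     = sorted p q p<i p<q q<n

    swapped-least : ∀ {f i j} → i ℕ.≤ j → f j ⊑ f i ≡ true →
      LeastUpTo i j f → LeastUpTo i (suc j) (swapped f i j)
    swapped-least {f} {i} {j} i≤j fj⊑fi least q i≤q q<1+j =
      subst (λ z → z ⊑ swapped f i j q ≡ true)
        (sym (trans (swapped-transpose f i j i) (cong f (transpose-i i j)))) below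
      where
      below : f j ⊑ swapped f i j q ≡ true
      below with q ℕ.≟ j
      ... | yes refl = fj⊑fi
      ... | no q≢j with q ℕ.≟ i
      ...   | yes refl = ⊑-refl
      ...   | no _     = ⊑-trans fj⊑fi (least q i≤q (ℕ.≤∧≢⇒< (ℕ.≤-pred q<1+j) q≢j))

    Least-extend : ∀ {f i j} → LeastUpTo i j f → (i ℕ.≤ j → f i ⊑ f j ≡ true) → LeastUpTo i (suc j) f
    Least-extend {j = j} least fi⊑fj q i≤q q<1+j with q ℕ.≟ j
    ... | yes refl = fi⊑fj i≤q
    ... | no q≢j   = least q i≤q (ℕ.≤∧≢⇒< (ℕ.≤-pred q<1+j) q≢j)

    -- The comparison is specified at every state with the same real arrays and the same natural
    -- arrays from 2 on: sorting writes only to `order`, and the keys of both orders in use lie in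
    -- the shared part.
    sort-correct : ∀ {le σ} →
      (∀ τ → rarr τ ≡ rarr σ → (∀ a → narr τ (2 ℕ.+ a) ≡ narr σ (2 ℕ.+ a)) →
        evalᵇ le τ ≡ narr τ order (nreg τ outer) ⊑ narr τ order (nreg τ inner)) →
      nreg σ numDisks ≡ n → Permutation n (narr σ order) →
      Terminates n (sort le) (λ τ → nreg τ numDisks ≡ n ×
        Permutation n (narr τ order) × Sorted n (narr τ order) ×
        rarr τ ≡ rarr σ × narr τ chosen ≡ narr σ chosen ×
        (∀ a → narr τ (2 ℕ.+ a) ≡ narr σ (2 ℕ.+ a))) σ
    sort-correct {le} {σ} le-eval σ0≡n perm =
      for-rule n OuterInv (λ ()) σ0≡n (n≤[1+n]^1 n) (λ _ _ _ inv → inv)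
        (perm , (λ _ _ ()) , refl , refl , λ _ → refl)
        λ i τ i<n τi τ0 (p , s , rest) →
          consequence (λ { {υ} (υ0 , υi , p , s , l , rest) → υi , υ0 , p , finish-row s l , rest })
            (for-rule n (InnerInv i) (λ ()) τ0 (n≤[1+n]^1 n) (λ _ _ _ inv → inv)
              (τi , p , s , (λ _ _ ()) , rest)
              λ j υ j<n υj υ0 inv → body i j υ i<n j<n υj υ0 inv)
      where
      Rest : State → Set
      Rest τ = rarr τ ≡ rarr σ × narr τ chosen ≡ narr σ chosen ×
        (∀ a → narr τ (2 ℕ.+ a) ≡ narr σ (2 ℕ.+ a))
      OuterInv : ℕ → State → Set
      OuterInv i τ = Permutation n (narr τ order) × Sorted i (narr τ order) × Rest τ
      InnerInv : ℕ → ℕ → State → Set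
      InnerInv i j τ = nreg τ outer ≡ i × Permutation n (narr τ order) ×
        Sorted i (narr τ order) × LeastUpTo i j (narr τ order) × Rest τ

      finish-row : ∀ {i f} → Sorted i f → LeastUpTo i n f → Sorted (suc i) f
      finish-row {i} sorted least p q p<1+i p<q q<n with p ℕ.≟ i
      ... | yes refl = least q (ℕ.<⇒≤ p<q) q<n
      ... | no p≢i   = sorted p q (ℕ.≤∧≢⇒< (ℕ.≤-pred p<1+i) p≢i) p<q q<n

      body : ∀ i j τ → i ℕ.< n → j ℕ.< n → nreg τ inner ≡ j → nreg τ numDisks ≡ n → InnerInv i j τ →
        Terminates n (if ((reg outer ≤ⁿ reg inner) andᵇ notᵇ le) then swap else skip)
          (λ υ → nreg υ inner ≡ j × nreg υ numDisks ≡ n × InnerInv i (suc j) υ) τ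
      body i j τ i<n j<n refl τ0 (refl , p , s , l , r , c , a) = if-rule
        (λ eq → let i≤ᵇj , ¬leᵇ = ∧-true eq
                    i≤j = does-true (nreg τ outer ℕ.≤? nreg τ inner) i≤ᵇj
                    fj⊑fi = ⊑-total (trans (sym (le-eval τ r a)) (not-true ¬leᵇ)) in
          ≔ⁿ⨾-rule ([]≔ⁿ⨾-rule ([]≔ⁿ-rule
            (refl , τ0 , refl , swapped-permutation i<n j<n p ,
             swapped-sorted i≤j j<n s , swapped-least i≤j fj⊑fi l , r , c , a))))
        (λ eq → skip-rule (refl , τ0 , refl , p , s ,
          Least-extend l (λ i≤j → trans (sym (le-eval τ r a))
            (not-false (∧-false eq (dec-true (nreg τ outer ℕ.≤? nreg τ inner) i≤j)))) ,
          r , c , a))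

-- Strips

mod3 : ℕ → ℕ
mod3 (suc (suc (suc k))) = mod3 k
mod3 k                   = k

mod3-gap : ∀ j k → mod3 j ≡ mod3 k → j ℕ.< k → 3 ℕ.+ j ℕ.≤ k
mod3-gap zero 1 () _
mod3-gap zero 2 () _
mod3-gap zero (suc (suc (suc k))) _ _ = s≤s (s≤s (s≤s z≤n))
mod3-gap 1 2 () _
mod3-gap 1 3 () _
mod3-gap 1 (suc (suc (suc (suc k)))) _ _ = s≤s (s≤s (s≤s (s≤s z≤n)))
mod3-gap 1 1 _ (s≤s ())
mod3-gap 2 1 _ (s≤s ())
mod3-gap 2 2 _ (s≤s (s≤s ()))
mod3-gap 2 3 () _
mod3-gap 2 4 () _
mod3-gap 2 (suc (suc (suc (suc (suc k))))) _ _ = s≤s (s≤s (s≤s (s≤s (s≤s z≤n))))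
mod3-gap (suc (suc (suc j))) (suc (suc (suc k))) eq (s≤s (s≤s (s≤s j<k))) =
  s≤s (s≤s (s≤s (mod3-gap j k eq j<k)))
mod3-gap (suc (suc (suc j))) 1 _ (s≤s ())
mod3-gap (suc (suc (suc j))) 2 _ (s≤s (s≤s ()))

mod3-suc : ∀ k → (mod3 k ≡ 2 → 0 ≡ mod3 (suc k)) × (mod3 k ≢ 2 → mod3 k ℕ.+ 1 ≡ mod3 (suc k))
mod3-suc 0 = (λ ()) , λ _ → refl
mod3-suc 1 = (λ ()) , λ _ → refl
mod3-suc 2 = (λ _ → refl) , λ 2≢2 → contradiction refl 2≢2
mod3-suc (suc (suc (suc k))) = mod3-suc k

mod3-cases : ∀ k → mod3 k ≡ 0 ⊎ mod3 k ≡ 1 ⊎ mod3 k ≡ 2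
mod3-cases 0 = inj₁ refl
mod3-cases 1 = inj₂ (inj₁ refl)
mod3-cases 2 = inj₂ (inj₂ refl)
mod3-cases (suc (suc (suc k))) = mod3-cases k

_or_ : Bool → Bool → Bool
x or y = not (not x ∧ not y)

or-true : ∀ {x y} → x or y ≡ true → x ≡ true ⊎ y ≡ true
or-true {true}          _ = inj₁ refl
or-true {false} {true}  _ = inj₂ refl
or-true {false} {false} ()

or-left : ∀ {x y} → x ≡ true → x or y ≡ true
or-left refl = refl

or-right : ∀ {x y} → y ≡ true → x or y ≡ true
or-right {true}  refl = refl
or-right {false} refl = refl

module Strips (ℝ : Reals) (n : ℕ) (X Y : ℕ → Reals.Carrier ℝ) where
  open RealRAM ℝ
  private module R = Reals ℝ
  open OrderedField ℝ
  open ProgramLogic ℝ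

  z : ℕ → R.Carrier
  z u = Y u R.+ Y u

  _≤h_ : ℕ → ℕ → Bool
  u ≤h w = does (z u R.≤? z w)

  ≤h-total : ∀ {u w} → u ≤h w ≡ false → w ≤h u ≡ true
  ≤h-total {u} {w} eq = dec-true (z w R.≤? z u) (≰⇒≥ (does-false (z u R.≤? z w) eq))

  ≤h-trans : ∀ {u v w} → u ≤h v ≡ true → v ≤h w ≡ true → u ≤h w ≡ true
  ≤h-trans {u} {v} {w} p q = dec-true (z u R.≤? z w)
    (≤-trans (does-true (z u R.≤? z v) p) (does-true (z v R.≤? z w) q))

  Covered : ℕ → ℕ → Set
  Covered s u = z s R.≤ z u × z u R.≤ z s R.+ three

  -- What is remembered of a placed centre `u` while strip `k` starts at `s`. The strip after that
  -- of `u` starts no lower than `u`, and each further one adds a doubled height of `three`. Classes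
  -- recur with period 3, so three gaps suffice.
  record Level (st cl k s u : ℕ) : Set where
    field
      st≤k : st ℕ.≤ k
      cl≡  : cl ≡ mod3 st
      same : st ≡ k → Covered s u
      gap₁ : st ℕ.< k → z u R.≤ z s
      gap₂ : 2 ℕ.+ st ℕ.≤ k → z u R.+ three R.≤ z s
      gap₃ : 3 ℕ.+ st ℕ.≤ k → z u R.+ three R.+ three R.≤ z s
  open Level

  record Separated (ST CL : ℕ → ℕ) (u w : ℕ) : Set where
    field
      same-strip : ST u ≡ ST w → z u R.≤ z w R.+ three
      same-class : ST u ℕ.< ST w → CL u ≡ CL w → z u R.+ three R.+ three R.≤ z w
  open Separated

  -- Each gap comes from the preceding gap to the old start, the new start being higher by `three`;
  -- `gap₁` is where the order by height enters.
  level-next : ∀ {st cl k s w u} → z s R.+ three R.≤ z w → z u R.≤ z w →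
    Level st cl k s u → Level st cl (suc k) w u
  level-next {st} {k = k} {s} {w} {u} s+3≤w u≤w l = record
    { st≤k = ℕ.m≤n⇒m≤1+n (st≤k l)
    ; cl≡  = cl≡ l
    ; same = λ { refl → contradiction (st≤k l) ℕ.1+n≰n }
    ; gap₁ = λ _ → u≤w
    ; gap₂ = λ { (s≤s st<k) → ≤-trans (R.+-mono-≤ three (gap₁ l st<k)) s+3≤w }
    ; gap₃ = λ { (s≤s 2+st≤k) → ≤-trans (R.+-mono-≤ three (gap₂ l 2+st≤k)) s+3≤w }
    }

  record Levels (i : ℕ) (ord ST CL : ℕ → ℕ) (k c s : ℕ) : Set where
    field
      class≡ : c ≡ mod3 k
      levels : ∀ {p} → p ℕ.< i → Level (ST (ord p)) (CL (ord p)) k s (ord p)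
      pairs  : ∀ {p q} → p ℕ.< i → q ℕ.< i → Separated ST CL (ord p) (ord q)
      start≤ : ∀ {q} → i ℕ.≤ q → q ℕ.< n → z s R.≤ z (ord q)
  open Levels

  z≤z+3 : ∀ u → z u R.≤ z u R.+ three
  z≤z+3 u = 0≤y-x⇒x≤y (≤-respʳ-≈
    (solve 2 (λ a b → b := a :+ b :- a) R.refl (z u) three) (0≤1 ⊹ 0≤1 ⊹ 0≤1))

  record-levels : ∀ {i ord ST CL k c s} → Permutation n ord → i ℕ.< n →
    Covered s (ord i) → Levels i ord ST CL k c s →
    Levels (suc i) ord (update ST (ord i) k) (update CL (ord i) c) k c s
  record-levels {i} {ord} {ST} {CL} {k} {c} {s} perm i<n (s≤w , w≤s+3) L = record
    { class≡ = class≡ L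
    ; levels = level′
    ; pairs  = pair
    ; start≤ = λ i<q q<n → start≤ L (ℕ.<⇒≤ i<q) q<n
    }
    where
    w = ord i
    ST′ = update ST w k
    CL′ = update CL w c

    apart : ∀ {p} → p ℕ.< i → ord p ≢ w
    apart p<i eq = ℕ.<⇒≢ p<i (Permutation.injective perm (ℕ.<-trans p<i i<n) i<n eq)

    level-w : Level k c k s w
    level-w = record
      { st≤k = ℕ.≤-refl
      ; cl≡  = class≡ L
      ; same = λ _ → s≤w , w≤s+3
      ; gap₁  = λ k<k → contradiction k<k ℕ.1+n≰n
      ; gap₂  = λ 2+k≤k → contradiction (ℕ.<⇒≤ 2+k≤k) ℕ.1+n≰n
      ; gap₃ = λ 3+k≤k → contradiction (ℕ.<⇒≤ (ℕ.<⇒≤ 3+k≤k)) ℕ.1+n≰n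
      }

    level′ : ∀ {p} → p ℕ.< suc i → Level (ST′ (ord p)) (CL′ (ord p)) k s (ord p)
    level′ {p} p<1+i with p ℕ.≟ i
    ... | yes refl = subst₂ (λ a b → Level a b k s w) (sym (update-≡ ST w k)) (sym (update-≡ CL w c)) level-w
    ... | no p≢i   = subst₂ (λ a b → Level a b k s (ord p))
      (sym (update-≢ ST k (apart p<i))) (sym (update-≢ CL c (apart p<i))) (levels L p<i)
      where p<i = ℕ.≤∧≢⇒< (ℕ.≤-pred p<1+i) p≢i

    pair : ∀ {p q} → p ℕ.< suc i → q ℕ.< suc i → Separated ST′ CL′ (ord p) (ord q)
    pair {p} {q} p<1+i q<1+i with p ℕ.≟ i | q ℕ.≟ i
    ... | yes refl | yes refl = record
      { same-strip = λ _ → z≤z+3 w ; same-class = λ k<k → contradiction k<k (ℕ.<-irrefl refl) }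
    ... | yes refl | no q≢i = record
      { same-strip = λ eq → ≤-trans w≤s+3 (R.+-mono-≤ three (proj₁ (same lq (trans (sym eq) (update-≡ ST w k)))))
      ; same-class = λ lt → contradiction (subst (ℕ._< ST′ (ord q)) (update-≡ ST w k) lt) (ℕ.≤⇒≯ (st≤k lq)) }
      where lq = level′ q<1+i
    ... | no p≢i | yes refl = record
      { same-strip = λ eq → ≤-trans (proj₂ (same lp (trans eq (update-≡ ST w k)))) (R.+-mono-≤ three s≤w)
      -- Strips of equal class with different numbers are at least three apart, so the widest gap
      -- applies.
      ; same-class = λ lt eq → ≤-trans (gap₃ lp (mod3-gap (ST′ (ord p)) k
          (trans (sym (cl≡ lp)) (trans eq (trans (update-≡ CL w c) (class≡ L))))
          (subst (ST′ (ord p) ℕ.<_) (update-≡ ST w k) lt))) s≤w }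
      where lp = level′ p<1+i
    ... | no p≢i | no q≢i = record
      { same-strip = λ eq → same-strip sep (trans (sym (st p<i)) (trans eq (st q<i)))
      ; same-class = λ lt eq → same-class sep (subst₂ ℕ._<_ (st p<i) (st q<i) lt)
          (trans (sym (cl p<i)) (trans eq (cl q<i))) }
      where
      p<i = ℕ.≤∧≢⇒< (ℕ.≤-pred p<1+i) p≢i
      q<i = ℕ.≤∧≢⇒< (ℕ.≤-pred q<1+i) q≢i
      sep = pairs L p<i q<i
      st : ∀ {p} → p ℕ.< i → ST′ (ord p) ≡ ST (ord p)
      st p<i = update-≢ ST k (apart p<i)
      cl : ∀ {p} → p ℕ.< i → CL′ (ord p) ≡ CL (ord p)
      cl p<i = update-≢ CL c (apart p<i)

  SortedByHeight : (ℕ → ℕ) → Set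
  SortedByHeight ord = ∀ p q → p ℕ.< n → p ℕ.< q → q ℕ.< n → ord p ≤h ord q ≡ true

  next-levels : ∀ {i ord ST CL k c s} → SortedByHeight ord → i ℕ.< n →
    z s R.+ three R.≤ z (ord i) → ∀ {c′} → c′ ≡ mod3 (suc k) →
    Levels i ord ST CL k c s → Levels i ord ST CL (suc k) c′ (ord i)
  next-levels {i} {ord} sorted i<n s+3≤w c′≡ L = record
    { class≡ = c′≡
    ; levels = λ p<i → level-next s+3≤w (before p<i i<n) (levels L p<i)
    ; pairs  = pairs L
    ; start≤ = after
    }
    where
    before : ∀ {p q} → p ℕ.< q → q ℕ.< n → z (ord p) R.≤ z (ord q)
    before {p} {q} p<q q<n =
      does-true (z (ord p) R.≤? z (ord q)) (sorted p q (ℕ.<-trans p<q q<n) p<q q<n)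
    after : ∀ {q} → i ℕ.≤ q → q ℕ.< n → z (ord i) R.≤ z (ord q)
    after {q} i≤q q<n with i ℕ.≟ q
    ... | yes refl = ≤-refl
    ... | no i≢q   = before (ℕ.≤∧≢⇒< i≤q i≢q) q<n

  assignStrips-correct : ∀ {σ} → nreg σ numDisks ≡ n →
    rarr σ ys ≡ Y → Permutation n (narr σ order) → SortedByHeight (narr σ order) →
    Terminates n assignStrips (λ τ → nreg τ numDisks ≡ n ×
      (∀ {p q} → p ℕ.< n → q ℕ.< n →
        Separated (narr τ stripOf) (narr τ classOf) (narr σ order p) (narr σ order q)) ×
      (∀ {p} → p ℕ.< n → ∃[ k ] narr τ classOf (narr σ order p) ≡ mod3 k) ×
      rarr τ ≡ rarr σ × narr τ order ≡ narr σ order × narr τ chosen ≡ narr σ chosen ×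
      (∀ a → narr τ (4 ℕ.+ a) ≡ narr σ (4 ℕ.+ a))) σ
  assignStrips-correct {σ} σ0 refl perm sorted = ≔ⁿ⨾-rule (≔ⁿ⨾-rule (≔ⁿ⨾-rule (consequence
    (λ { {τ} (τ0 , L , rest) →
      τ0 , pairs L , (λ {p} p<n → narr τ stripOf (ord p) , cl≡ (levels L p<n)) , rest })
    (for-rule n Inv (λ ()) σ0 (n≤[1+n]^1 n) (λ _ _ _ inv → inv)
      (initial , refl , refl , refl , λ _ → refl) body))))
    where
    ord = narr σ order
    Rest Mid : State → Set
    Rest τ = rarr τ ≡ rarr σ × narr τ order ≡ ord × narr τ chosen ≡ narr σ chosen ×
      (∀ a → narr τ (4 ℕ.+ a) ≡ narr σ (4 ℕ.+ a))
    Lev : ℕ → State → Set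
    Lev i τ = Levels i ord (narr τ stripOf) (narr τ classOf) (nreg τ strip) (nreg τ class) (nreg τ start)
    Inv : ℕ → State → Set
    Inv i τ = Lev i τ × Rest τ
    Mid τ = nreg τ outer ℕ.< n × nreg τ numDisks ≡ n ×
      Covered (nreg τ start) (ord (nreg τ outer)) × Lev (nreg τ outer) τ × Rest τ

    initial : Levels 0 ord (narr σ stripOf) (narr σ classOf) 0 0 (ord 0)
    initial = record
      { class≡ = refl
      ; levels = λ ()
      ; pairs  = λ ()
      ; start≤ = λ {q} _ q<n → least q q<n
      }
      where
      least : ∀ q → q ℕ.< n → z (ord 0) R.≤ z (ord q)
      least zero    _   = ≤-refl
      least (suc q) q<n = does-true (z (ord 0) R.≤? z (ord (suc q)))
        (sorted 0 (suc q) (ℕ.≤-<-trans z≤n q<n) (s≤s z≤n) q<n)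

    record-step : ∀ i υ → nreg υ outer ≡ i → Mid υ →
      Terminates n record-strip (λ υ → nreg υ outer ≡ i × nreg υ numDisks ≡ n × Inv (suc i) υ) υ
    record-step i υ refl (i<n , υ0 , cov , L , ρ≡ , ord≡ , ch , rest) = []≔ⁿ⨾-rule ([]≔ⁿ-rule
      (refl , υ0 ,
       subst (λ f → Levels (suc i) ord
           (update (narr υ stripOf) (f i) (nreg υ strip)) (update (narr υ classOf) (f i) (nreg υ class))
           (nreg υ strip) (nreg υ class) (nreg υ start)) (sym ord≡)
         (record-levels perm i<n cov L) ,
       ρ≡ , ord≡ , ch , rest))

    body : ∀ i τ → i ℕ.< n → nreg τ outer ≡ i → nreg τ numDisks ≡ n → Inv i τ →
      Terminates n ((if fitsStrip then skip else nextStrip) ⨾ record-strip)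
        (λ υ → nreg υ outer ≡ i × nreg υ numDisks ≡ n × Inv (suc i) υ) τ
    body i τ i<n refl τ0 (L , ρ≡ , ord≡ , ch , rest) = ⨾-rule {R = λ υ → nreg υ outer ≡ i × Mid υ}
      (if-rule
        (λ eq → skip-rule (refl , i<n , τ0 ,
          (start≤ L ℕ.≤-refl i<n , fits (trans (sym fits-eval) eq)) , L , ρ≡ , ord≡ , ch , rest))
        (λ eq → ≔ⁿ⨾-rule (≔ⁿ⨾-rule (if-rule
          (λ c≡2 → ≔ⁿ-rule (advance (misfit (trans (sym fits-eval) eq))
            (proj₁ (mod3-suc (nreg τ strip)) (trans (sym (class≡ L)) (does-true (nreg τ class ℕ.≟ 2) c≡2)))))
          (λ c≢2 → ≔ⁿ-rule (advance (misfit (trans (sym fits-eval) eq))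
            (trans (cong (ℕ._+ 1) (class≡ L)) (proj₂ (mod3-suc (nreg τ strip))
              (does-false (nreg τ class ℕ.≟ 2) c≢2 ∘ trans (class≡ L))))))))))
      (λ { υ (υi , mid) → record-step i υ υi mid })
      where
      fitsᵇ : Bool
      fitsᵇ = does (z (ord i) R.≤? (z (nreg τ start) R.+ three))
      fits-eval : evalᵇ fitsStrip τ ≡ fitsᵇ
      fits-eval = cong₂ (λ r f → does ((r ys (f i) R.+ r ys (f i)) R.≤?
        (r ys (nreg τ start) R.+ r ys (nreg τ start) R.+ three))) ρ≡ ord≡
      fits : fitsᵇ ≡ true → z (ord i) R.≤ z (nreg τ start) R.+ three
      fits = does-true (z (ord i) R.≤? (z (nreg τ start) R.+ three))
      misfit : fitsᵇ ≡ false → z (nreg τ start) R.+ three R.≤ z (ord i)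
      misfit eq = ≰⇒≥ (does-false (z (ord i) R.≤? (z (nreg τ start) R.+ three)) eq)
      advance : z (nreg τ start) R.+ three R.≤ z (ord i) → ∀ {c′} → c′ ≡ mod3 (suc (nreg τ strip)) →
        i ≡ i × i ℕ.< n × nreg τ numDisks ≡ n × Covered (narr τ order i) (ord i) ×
          Levels i ord (narr τ stripOf) (narr τ classOf) (nreg τ strip ℕ.+ 1) c′ (narr τ order i) × Rest τ
      advance s+3≤w {c′} c′≡ = refl , i<n , τ0 ,
        subst (λ f → Covered (f i) (ord i)) (sym ord≡) (≤-refl , z≤z+3 (ord i)) ,
        subst₂ (λ f k → Levels i ord (narr τ stripOf) (narr τ classOf) k c′ (f i)) (sym ord≡)
          (ℕ.+-comm 1 (nreg τ strip)) (next-levels sorted i<n s+3≤w c′≡ L) ,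
        ρ≡ , ord≡ , ch , rest

-- Dynamic programming on pairs of chains

∧-intro : ∀ {x y} → x ≡ true → y ≡ true → x ∧ y ≡ true
∧-intro refl eq = eq

update-< : ∀ {A : Set} (f : ℕ → A) {m s} v → s ℕ.< m → update f m v s ≡ f s
update-< f v s<m = update-≢ f v (ℕ.<⇒≢ s<m)

module ChainPairs (ok : ℕ → ℕ → Bool) where

  -- The union of two disjoint chains, listed downwards, with the ends encoded
  -- as for `continues`; the first end is the later one.
  data ChainPair : ℕ → ℕ → List ℕ → Set where
    empty   : ChainPair 0 0 []
    onLast  : ∀ {p q v L} → ChainPair p q L → p ℕ.≤ v → ok p v ≡ true → ChainPair (suc v) q (v ∷ L)
    onOther : ∀ {p q v L} → ChainPair p q L → p ℕ.≤ v → ok q v ≡ true → ChainPair (suc v) p (v ∷ L)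

  other≤last : ∀ {p q L} → ChainPair p q L → q ℕ.≤ p
  other≤last empty            = z≤n
  other≤last (onLast c p≤v _)  = ℕ.m≤n⇒m≤1+n (ℕ.≤-trans (other≤last c) p≤v)
  other≤last (onOther c p≤v _) = ℕ.m≤n⇒m≤1+n p≤v

  -- The later end grows strictly with every element. This bounds the number of extraction steps by
  -- `n`.
  length≤last : ∀ {p q L} → ChainPair p q L → length L ℕ.≤ p
  length≤last empty             = z≤n
  length≤last (onLast c p≤v _)  = s≤s (ℕ.≤-trans (length≤last c) p≤v)
  length≤last (onOther c p≤v _) = s≤s (ℕ.≤-trans (length≤last c) p≤v)

  -- The list read off by following `p` from row `s`. All rows met lie below `m`, so rows appended
  -- later do not disturb it.
  Path : ℕ → (h p : ℕ → ℕ) → ℕ → List ℕ → Set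
  Path m h p s []      = ⊤
  Path m h p s (x ∷ L) = s ℕ.< m × h s ≡ suc x × Path m h p (p s) L

  path-append : ∀ {m h p a b} s L → Path m h p s L → Path (suc m) (update h m a) (update p m b) s L
  path-append s [] _ = tt
  path-append {m} {h} {p} {a} {b} s (x ∷ L) (s<m , hs≡ , path) =
    ℕ.m<n⇒m<1+n s<m , trans (update-< h a s<m) hs≡ ,
    subst (λ t → Path (suc m) (update h m a) (update p m b) t L) (sym (update-< p b s<m))
      (path-append (p s) L path)

  candidateᵇ : (h l : ℕ → ℕ) (v b s : ℕ) → Bool
  candidateᵇ h l v b s = (does (l s ℕ.≟ b) ∧ ok (h s) v) or (does (h s ℕ.≟ b) ∧ ok (l s) v)

  candidate-extends : ∀ {h l v b s L} → ChainPair (h s) (l s) L → h s ℕ.≤ v →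
    candidateᵇ h l v b s ≡ true → ChainPair (suc v) b (v ∷ L)
  candidate-extends {h} {l} {v} {b} {s} c h≤v eq with or-true {does (l s ℕ.≟ b) ∧ ok (h s) v} eq
  ... | inj₁ both with ∧-true both
  ...   | l≡b , okᵇ with does-true (l s ℕ.≟ b) l≡b
  ...     | refl = onLast c h≤v okᵇ
  candidate-extends {h} {l} {v} {b} {s} c h≤v eq | inj₂ both with ∧-true both
  ...   | h≡b , okᵇ with does-true (h s ℕ.≟ b) h≡b
  ...     | refl = onOther c h≤v okᵇ

  module _ (n : ℕ) where

    -- The invariant while pairs ending in position `v` are being made: the `m₀` old rows settle all
    -- pairs with ends coded at most `v`, and the rows so far settle those with end `suc v` and
    -- other end below `b`. To settle a pair is to have a row with the same ends and at least its
    -- length, as extensions depend on nothing else.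
    record Table (v b m₀ m top : ℕ) (h l z p : ℕ → ℕ) : Set where
      field
        m₀≤m    : m₀ ℕ.≤ m
        m≤      : m ℕ.≤ suc (v ℕ.* n ℕ.+ b)
        oldLast : ∀ {s} → s ℕ.< m₀ → h s ℕ.≤ v
        newLast : ∀ {s} → s ℕ.< m → h s ℕ.≤ suc v
        sound   : ∀ {s} → s ℕ.< m → ∃[ L ] Path m h p s L × ChainPair (h s) (l s) L × z s ≡ length L
        oldComplete : ∀ {a c L} → ChainPair a c L → a ℕ.≤ v →
          ∃[ s ] s ℕ.< m₀ × h s ≡ a × l s ≡ c × length L ℕ.≤ z s
        newComplete : ∀ {c L} → ChainPair (suc v) c L → c ℕ.< b →
          ∃[ s ] s ℕ.< m × h s ≡ suc v × l s ≡ c × length L ℕ.≤ z s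
        top<m   : top ℕ.< m
        topMax  : ∀ {s} → s ℕ.< m → z s ℕ.≤ z top
    open Table

    table-start : ∀ {h l z p} → h 0 ≡ 0 → l 0 ≡ 0 → z 0 ≡ 0 → Table 0 0 1 1 0 h l z p
    table-start {h} {l} {z} {p} h0 l0 z0 = record
      { m₀≤m    = ℕ.≤-refl
      ; m≤      = ℕ.≤-refl
      ; oldLast = λ { (s≤s z≤n) → ℕ.≤-reflexive h0 }
      ; newLast = λ { (s≤s z≤n) → ℕ.≤-trans (ℕ.≤-reflexive h0) z≤n }
      ; sound   = λ { (s≤s z≤n) → [] , tt , subst₂ (λ a c → ChainPair a c []) (sym h0) (sym l0) empty , z0 }
      ; oldComplete = λ { empty _ → 0 , s≤s z≤n , h0 , l0 , z≤n }
      ; newComplete = λ _ ()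
      ; top<m   = s≤s z≤n
      ; topMax  = λ { (s≤s z≤n) → ℕ.≤-refl }
      }

    -- The other end lies before `v`, so its code is at most `v` and hence below `n`: the values of
    -- `inner` below `n` have met every possible other end.
    table-begin-row : ∀ {v m₀ m top h l z p} → v ℕ.< n →
      Table v n m₀ m top h l z p → Table (suc v) 0 m m top h l z p
    table-begin-row {v} {m₀} {m} {h = h} {l} {z} v<n T = record
      { m₀≤m    = ℕ.≤-refl
      ; m≤      = ℕ.≤-trans (m≤ T) (ℕ.≤-reflexive (cong suc
                    (trans (ℕ.+-comm (v ℕ.* n) n) (sym (ℕ.+-identityʳ _)))))
      ; oldLast = newLast T
      ; newLast = λ s<m → ℕ.m≤n⇒m≤1+n (newLast T s<m)
      ; sound   = sound T
      ; oldComplete = complete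
      ; newComplete = λ _ ()
      ; top<m   = top<m T
      ; topMax  = topMax T
      }
      where
      complete : ∀ {a c L} → ChainPair a c L → a ℕ.≤ suc v →
        ∃[ s ] s ℕ.< m × h s ≡ a × l s ≡ c × length L ℕ.≤ z s
      complete {a} c a≤1+v with a ℕ.≟ suc v
      complete {a} c@(onLast d p≤v _) a≤1+v | yes refl =
        newComplete T c (ℕ.≤-<-trans (ℕ.≤-trans (other≤last d) p≤v) v<n)
      complete {a} c@(onOther d p≤v _) a≤1+v | yes refl = newComplete T c (ℕ.≤-<-trans p≤v v<n)
      ... | no a≢1+v with oldComplete T c (ℕ.≤-pred (ℕ.≤∧≢⇒< a≤1+v a≢1+v))
      ...   | s , s<m₀ , rest = s , ℕ.<-≤-trans s<m₀ (m₀≤m T) , rest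

    -- Optimal substructure: without its top position the pair has ends at most `v`, an old row with
    -- the same ends is at least as long, and the candidate test sees only the ends.
    pairs-candidate : ∀ {v b m₀ m top h l z p L} → Table v b m₀ m top h l z p →
      ChainPair (suc v) b L →
      ∃[ s ] s ℕ.< m₀ × candidateᵇ h l v b s ≡ true × length L ℕ.≤ suc (z s)
    pairs-candidate {v} {b} {h = h} {l} T (onLast c p≤v okᵇ) with oldComplete T c p≤v
    ... | s , s<m₀ , refl , refl , len =
      s , s<m₀ , or-left (∧-intro (dec-true (l s ℕ.≟ l s) refl) okᵇ) , s≤s len
    pairs-candidate {v} {b} {h = h} {l} T (onOther c p≤v okᵇ) with oldComplete T c p≤v
    ... | s , s<m₀ , refl , refl , len =
      s , s<m₀ , or-right {does (l s ℕ.≟ h s) ∧ ok (h s) v} (∧-intro (dec-true (h s ℕ.≟ h s) refl) okᵇ) , s≤s len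

    Upper : (h l z : ℕ → ℕ) (v b k bs : ℕ) → Set
    Upper h l z v b k bs = ∀ s → s ℕ.< k → candidateᵇ h l v b s ≡ true → suc (z s) ℕ.≤ bs

    table-skip : ∀ {v b m₀ m top h l z p} → Upper h l z v b m₀ 0 →
      Table v b m₀ m top h l z p → Table v (suc b) m₀ m top h l z p
    table-skip {v} {b} {m = m} {h = h} {l} {z} none T = record
      { m₀≤m    = m₀≤m T
      ; m≤      = ℕ.≤-trans (m≤ T) (s≤s (ℕ.+-monoʳ-≤ (v ℕ.* n) (ℕ.n≤1+n b)))
      ; oldLast = oldLast T
      ; newLast = newLast T
      ; sound   = sound T
      ; oldComplete = oldComplete T
      ; newComplete = complete
      ; top<m   = top<m T
      ; topMax  = topMax T
      }
      where
      complete : ∀ {c L} → ChainPair (suc v) c L → c ℕ.< suc b →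
        ∃[ s ] s ℕ.< m × h s ≡ suc v × l s ≡ c × length L ℕ.≤ z s
      complete {c} d c<1+b with c ℕ.≟ b
      ... | no c≢b = newComplete T d (ℕ.≤∧≢⇒< (ℕ.≤-pred c<1+b) c≢b)
      ... | yes refl with pairs-candidate T d
      ...   | s , s<m₀ , cand , _ with () ← none s s<m₀ cand

    table-append : ∀ {v b m₀ m top h l z p k} →
      k ℕ.< m₀ → candidateᵇ h l v b k ≡ true → Upper h l z v b m₀ (suc (z k)) →
      ∀ top′ → (top′ ≡ top × suc (z k) ℕ.≤ z top ⊎ top′ ≡ m × z top ℕ.≤ suc (z k)) →
      Table v b m₀ m top h l z p →
      Table v (suc b) m₀ (suc m) top′
        (update h m (suc v)) (update l m b) (update z m (suc (z k))) (update p m k)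
    table-append {v} {b} {m₀} {m} {top} {h} {l} {z} {p} {k} k<m₀ cand upper top′ top′≡ T = record
      { m₀≤m    = ℕ.m≤n⇒m≤1+n (m₀≤m T)
      ; m≤      = ℕ.≤-trans (s≤s (m≤ T)) (ℕ.≤-reflexive (cong suc (sym (ℕ.+-suc (v ℕ.* n) b))))
      ; oldLast = λ s<m₀ → subst (ℕ._≤ v) (sym (update-< h (suc v) (ℕ.<-≤-trans s<m₀ (m₀≤m T)))) (oldLast T s<m₀)
      ; newLast = last≤
      ; sound   = sound′
      ; oldComplete = λ c a≤v → weaken (oldComplete T c a≤v)
      ; newComplete = complete
      ; top<m   = top<
      ; topMax  = max
      }
      where
      h′ = update h m (suc v)
      l′ = update l m b
      z′ = update z m (suc (z k))
      p′ = update p m k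

      weaken : ∀ {a c x} → ∃[ s ] s ℕ.< m₀ × h s ≡ a × l s ≡ c × x ℕ.≤ z s →
        ∃[ s ] s ℕ.< m₀ × h′ s ≡ a × l′ s ≡ c × x ℕ.≤ z′ s
      weaken (s , s<m₀ , hs , ls , x≤) = s , s<m₀ ,
        trans (update-< h (suc v) s<m) hs , trans (update-< l b s<m) ls ,
        subst (_ ℕ.≤_) (sym (update-< z (suc (z k)) s<m)) x≤
        where s<m = ℕ.<-≤-trans s<m₀ (m₀≤m T)

      last≤ : ∀ {s} → s ℕ.< suc m → h′ s ℕ.≤ suc v
      last≤ {s} s<1+m with s ℕ.≟ m
      ... | yes refl = ℕ.≤-refl
      ... | no s≢m   = newLast T (ℕ.≤∧≢⇒< (ℕ.≤-pred s<1+m) s≢m)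

      sound′ : ∀ {s} → s ℕ.< suc m →
        ∃[ L ] Path (suc m) h′ p′ s L × ChainPair (h′ s) (l′ s) L × z′ s ≡ length L
      sound′ {s} s<1+m with s ℕ.<? m
      ... | yes s<m with sound T s<m
      ...   | L , path , c , eq = L , path-append s L path ,
        subst₂ (λ a c → ChainPair a c L) (sym (update-< h (suc v) s<m)) (sym (update-< l b s<m)) c ,
        trans (update-< z (suc (z k)) s<m) eq
      sound′ {s} s<1+m | no s≮m with ℕ.≤-antisym (ℕ.≤-pred s<1+m) (ℕ.≮⇒≥ s≮m)
      ... | refl with sound T (ℕ.<-≤-trans k<m₀ (m₀≤m T))
      ...   | L , path , c , eq = v ∷ L ,
        (ℕ.≤-refl , update-≡ h m (suc v) ,
         subst (λ t → Path (suc m) h′ p′ t L) (sym (update-≡ p m k)) (path-append k L path)) ,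
        subst₂ (λ a c → ChainPair a c (v ∷ L)) (sym (update-≡ h m (suc v))) (sym (update-≡ l m b))
          (candidate-extends {h} {l} {s = k} c (oldLast T k<m₀) cand) ,
        trans (update-≡ z m (suc (z k))) (cong suc eq)

      complete : ∀ {c L} → ChainPair (suc v) c L → c ℕ.< suc b →
        ∃[ s ] s ℕ.< suc m × h′ s ≡ suc v × l′ s ≡ c × length L ℕ.≤ z′ s
      complete {c} d c<1+b with c ℕ.≟ b
      ... | no c≢b with newComplete T d (ℕ.≤∧≢⇒< (ℕ.≤-pred c<1+b) c≢b)
      ...   | s , s<m , hs , ls , len = s , ℕ.m<n⇒m<1+n s<m ,
        trans (update-< h (suc v) s<m) hs , trans (update-< l b s<m) ls ,
        subst (_ ℕ.≤_) (sym (update-< z (suc (z k)) s<m)) len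
      complete {c} d c<1+b | yes refl with pairs-candidate T d
      ... | s , s<m₀ , cand′ , len = m , ℕ.≤-refl , update-≡ h m (suc v) , update-≡ l m b ,
        subst (_ ℕ.≤_) (sym (update-≡ z m (suc (z k)))) (ℕ.≤-trans len (upper s s<m₀ cand′))

      top< : top′ ℕ.< suc m
      top< = [ (λ (eq , _) → subst (ℕ._< suc m) (sym eq) (ℕ.m<n⇒m<1+n (top<m T)))
             , (λ (eq , _) → subst (ℕ._< suc m) (sym eq) ℕ.≤-refl) ]′ top′≡

      z′top : suc (z k) ℕ.≤ z′ top′ × z top ℕ.≤ z′ top′
      z′top =
        [ (λ (eq , le) → subst (λ x → suc (z k) ℕ.≤ x × z top ℕ.≤ x)
            (sym (trans (cong z′ eq) (update-< z (suc (z k)) (top<m T)))) (le , ℕ.≤-refl))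
        , (λ (eq , le) → subst (λ x → suc (z k) ℕ.≤ x × z top ℕ.≤ x)
            (sym (trans (cong z′ eq) (update-≡ z m (suc (z k))))) (ℕ.≤-refl , le)) ]′ top′≡

      max : ∀ {s} → s ℕ.< suc m → z′ s ℕ.≤ z′ top′
      max {s} s<1+m with s ℕ.≟ m
      ... | yes refl = proj₁ z′top
      ... | no s≢m   = ℕ.≤-trans (topMax T (ℕ.≤∧≢⇒< (ℕ.≤-pred s<1+m) s≢m)) (proj₂ z′top)

-- Correctness of table building and extraction

module Building (ℝ : Reals) where
  open RealRAM ℝ
  private module R = Reals ℝ
  open OrderedField ℝ
  open ProgramLogic ℝ

  nearᵇ : (Name → ℕ → R.Carrier) → ℕ → ℕ → Bool
  nearᵇ ρ u w = does
    ((ρ xs u R.- ρ xs w) R.* (ρ xs u R.- ρ xs w) R.+ (ρ ys u R.- ρ ys w) R.* (ρ ys u R.- ρ ys w) R.≤? four)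

  continuesᵇ : (Name → ℕ → R.Carrier) → (ord CL : ℕ → ℕ) → ℕ → ℕ → Bool
  continuesᵇ ρ ord CL p v = does (p ℕ.≟ 0) or
    (does (CL (ord (p ℕ.∸ 1)) ℕ.≟ CL (ord v)) ∧ not (nearᵇ ρ (ord (p ℕ.∸ 1)) (ord v)))

  module _ (n : ℕ) (ρ : Name → ℕ → R.Carrier) (ord CL : ℕ → ℕ) where
    ok = continuesᵇ ρ ord CL
    open ChainPairs ok

    Context : State → Set
    Context τ = rarr τ ≡ ρ × narr τ order ≡ ord × narr τ classOf ≡ CL × narr τ chosen ≡ λ _ → 0

    candidate-eval : ∀ τ → Context τ → evalᵇ candidate τ ≡
      candidateᵇ (narr τ last) (narr τ other) (nreg τ outer) (nreg τ inner) (nreg τ scan)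
    candidate-eval τ (ρ≡ , ord≡ , CL≡ , _) = by-cong (narr τ last) (narr τ other) ρ≡ ord≡ CL≡
      where
      by-cong : ∀ {ρ′ ord′ CL′ v b s} h l → ρ′ ≡ ρ → ord′ ≡ ord → CL′ ≡ CL →
        ChainPairs.candidateᵇ (continuesᵇ ρ′ ord′ CL′) h l v b s ≡ candidateᵇ h l v b s
      by-cong _ _ refl refl refl = refl

    TableAt : ℕ → ℕ → ℕ → State → Set
    TableAt v b m₀ τ = Table n v b m₀ (nreg τ count) (nreg τ best)
      (narr τ last) (narr τ other) (narr τ size) (narr τ pred)

    open Table

    -- Fits the scan of the old rows into the allowance of guard degree 2.
    ≤-square : ∀ {v b m} → v ℕ.< n → b ℕ.≤ n → m ℕ.≤ suc (v ℕ.* n ℕ.+ b) → m ℕ.≤ suc n ℕ.^ 2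
    ≤-square {v} {b} {m} v<n b≤n m≤ = begin
      m                             ≤⟨ m≤ ⟩
      suc (v ℕ.* n ℕ.+ b)           ≤⟨ s≤s (ℕ.+-monoʳ-≤ (v ℕ.* n) b≤n) ⟩
      suc (v ℕ.* n ℕ.+ n)           ≡⟨ cong suc (ℕ.+-comm (v ℕ.* n) n) ⟩
      suc (suc v ℕ.* n)             ≤⟨ s≤s (ℕ.*-monoˡ-≤ n v<n) ⟩
      suc (n ℕ.* n)                 ≤⟨ s≤s (ℕ.*-monoʳ-≤ n (ℕ.n≤1+n n)) ⟩
      suc (n ℕ.* suc n)             ≤⟨ ℕ.+-monoˡ-≤ (n ℕ.* suc n) (s≤s z≤n) ⟩
      suc n ℕ.* suc n               ≡⟨ cong (suc n ℕ.*_) (ℕ.*-identityʳ (suc n)) ⟨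
      suc n ℕ.^ 2                   ∎
      where open ℕ.≤-Reasoning

    Found : (h l z : ℕ → ℕ) (v b m₀ k bs bp : ℕ) → Set
    Found h l z v b m₀ k bs bp =
      (bs ≡ 0 ⊎ bp ℕ.< m₀ × bs ≡ suc (z bp) × candidateᵇ h l v b bp ≡ true) ×
      Upper n h l z v b k bs

    upper-extend : ∀ h l {z v b k bs bs′} → bs ℕ.≤ bs′ →
      (candidateᵇ h l v b k ≡ true → suc (z k) ℕ.≤ bs′) →
      Upper n h l z v b k bs → Upper n h l z v b (suc k) bs′
    upper-extend h l {k = k} bs≤ new upper s s<1+k cand with s ℕ.≟ k
    ... | yes refl = new cand
    ... | no s≢k   = ℕ.≤-trans (upper s (ℕ.≤∧≢⇒< (ℕ.≤-pred s<1+k) s≢k) cand) bs≤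

    Row : ℕ → ℕ → ℕ → State → Set
    Row v b m₀ τ = nreg τ outer ≡ v × nreg τ old ≡ m₀ × Context τ × TableAt v b m₀ τ

    FoundAt : ℕ → ℕ → ℕ → ℕ → State → Set
    FoundAt v b m₀ k τ =
      Found (narr τ last) (narr τ other) (narr τ size) v b m₀ k (nreg τ bestSize) (nreg τ bestPred)

    improve-correct : ∀ {v b m₀} k τ → k ℕ.< m₀ → nreg τ scan ≡ k → nreg τ old ≡ m₀ →
      nreg τ numDisks ≡ n × nreg τ inner ≡ b × Row v b m₀ τ × FoundAt v b m₀ k τ →
      Terminates n improve (λ υ → nreg υ scan ≡ k × nreg υ old ≡ m₀ ×
        nreg υ numDisks ≡ n × nreg υ inner ≡ b × Row v b m₀ υ × FoundAt v b m₀ (suc k) υ) τ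
    improve-correct k τ k<m₀ refl τold (τ0 , refl , row@(refl , _ , context , T) , found , upper) = if-rule
      (λ eq → let cand , bs≤z = ∧-true eq
                  cand′ = trans (sym (candidate-eval τ context)) cand
                  bs≤zk = does-true (nreg τ bestSize ℕ.≤? narr τ size k) bs≤z
                  1+z≡ = sym (ℕ.+-comm (narr τ size k) 1) in
        ≔ⁿ⨾-rule (≔ⁿ-rule (refl , τold , τ0 , refl , row ,
          inj₂ (k<m₀ , sym 1+z≡ , cand′) ,
          upper-extend (narr τ last) (narr τ other) (ℕ.≤-trans bs≤zk (ℕ.m≤m+n _ 1))
            (λ _ → ℕ.≤-reflexive 1+z≡) upper)))
      (λ eq → skip-rule (refl , τold , τ0 , refl , row , found ,
        upper-extend (narr τ last) (narr τ other) ℕ.≤-refl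
          (λ cand → ℕ.≰⇒> (does-false (nreg τ bestSize ℕ.≤? narr τ size k)
            (∧-false eq (trans (candidate-eval τ context) cand)))) upper))

    append-correct : ∀ {v b m₀} τ → nreg τ numDisks ≡ n → nreg τ inner ≡ b → Row v b m₀ τ →
      FoundAt v b m₀ m₀ τ → nreg τ bestSize ≢ 0 →
      Terminates n append (λ υ → nreg υ inner ≡ b × nreg υ numDisks ≡ n × Row v (suc b) m₀ υ) τ
    append-correct τ τ0 refl _ (inj₁ bs≡0 , _) bs≢0 = contradiction bs≡0 bs≢0
    append-correct {b = b} {m₀} τ τ0 refl (refl , τold , context , T) (inj₂ (bp<m₀ , bs≡ , cand) , upper) _ =
      []≔ⁿ⨾-rule ([]≔ⁿ⨾-rule ([]≔ⁿ⨾-rule ([]≔ⁿ⨾-rule (⨾-rule {R = λ υ →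
          nreg υ inner ≡ b × nreg υ numDisks ≡ n × nreg υ outer ≡ v × nreg υ old ≡ m₀ × Context υ ×
          Table n v (suc b) m₀ (nreg υ count ℕ.+ 1) (nreg υ best)
            (narr υ last) (narr υ other) (narr υ size) (narr υ pred)}
        (if-rule
          (λ eq → skip-rule (refl , τ0 , refl , τold , context ,
            appended (nreg τ best) (inj₁ (refl ,
              subst₂ ℕ._≤_ bs≡ sizeOfBest (does-true (bs ℕ.≤? z′ (nreg τ best)) eq)))))
          (λ eq → ≔ⁿ-rule (refl , τ0 , refl , τold , context ,
            appended m (inj₂ (refl , subst₂ ℕ._≤_ sizeOfBest bs≡
              (ℕ.<⇒≤ (ℕ.≰⇒> (does-false (bs ℕ.≤? z′ (nreg τ best)) eq))))))))
        λ υ (υi , υ0 , υo , υold , context , T) → ≔ⁿ-rule (υi , υ0 , υo , υold , context , T)))))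
      where
      v = nreg τ outer
      m = nreg τ count
      bs = nreg τ bestSize
      z = narr τ size
      z′ = update z m bs
      sizeOfBest : z′ (nreg τ best) ≡ z (nreg τ best)
      sizeOfBest = update-< z bs (top<m T)
      appended : ∀ top′ → (top′ ≡ nreg τ best × suc (z (nreg τ bestPred)) ℕ.≤ z (nreg τ best) ⊎
          top′ ≡ m × z (nreg τ best) ℕ.≤ suc (z (nreg τ bestPred))) →
        Table n v (suc b) m₀ (m ℕ.+ 1) top′
          (update (narr τ last) m (v ℕ.+ 1)) (update (narr τ other) m b)
          z′ (update (narr τ pred) m (nreg τ bestPred))
      appended top′ top′≡ = subst₂ (λ x y → Table n v (suc b) m₀ x top′
          (update (narr τ last) m y) (update (narr τ other) m b)
          z′ (update (narr τ pred) m (nreg τ bestPred)))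
        (ℕ.+-comm 1 m) (ℕ.+-comm 1 v)
        (subst (λ x → Table n v (suc b) m₀ (suc m) top′
            (update (narr τ last) m (suc v)) (update (narr τ other) m b)
            (update z m x) (update (narr τ pred) m (nreg τ bestPred)))
          (sym bs≡)
          (table-append n bp<m₀ cand (subst (Upper n (narr τ last) (narr τ other) z v b m₀) bs≡ upper)
            top′ top′≡ T))

    search-correct : ∀ {v m₀} b τ → v ℕ.< n → b ℕ.< n → nreg τ inner ≡ b → nreg τ numDisks ≡ n →
      Row v b m₀ τ →
      Terminates n search (λ υ → nreg υ inner ≡ b × nreg υ numDisks ≡ n × Row v (suc b) m₀ υ) τ
    search-correct {v} {m₀} b τ v<n b<n τi τ0 row@(τo , τold , context , T) = ≔ⁿ⨾-rule (⨾-rule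
      (for-rule m₀ (λ k υ → nreg υ numDisks ≡ n × nreg υ inner ≡ b × Row v b m₀ υ × FoundAt v b m₀ k υ)
        (λ ()) τold (≤-square v<n (ℕ.<⇒≤ b<n) (ℕ.≤-trans (m₀≤m T) (m≤ T)))
        (λ _ _ _ inv → inv) (τ0 , τi , row , inj₁ refl , λ _ ()) improve-correct)
      λ υ (_ , υ0 , υi , row@(υo , υold , context , T) , found) → if-rule
        (λ eq → skip-rule (υi , υ0 , υo , υold , context , table-skip n
          (λ s s<m₀ cand → ℕ.≤-trans (proj₂ found s s<m₀ cand) (does-true (nreg υ bestSize ℕ.≤? 0) eq)) T))
        (λ eq → append-correct υ υ0 υi row found
          λ bs≡0 → does-false (nreg υ bestSize ℕ.≤? 0) eq (ℕ.≤-reflexive bs≡0)))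

    buildTable-correct : ∀ {σ} → nreg σ numDisks ≡ n → Context σ →
      narr σ last 0 ≡ 0 → narr σ other 0 ≡ 0 → narr σ size 0 ≡ 0 →
      Terminates n buildTable (λ τ → nreg τ numDisks ≡ n × Context τ × TableAt n 0 (nreg τ count) τ) σ
    buildTable-correct {σ} σ0 context l0 o0 s0 = ≔ⁿ⨾-rule (≔ⁿ⨾-rule
      (for-rule n (λ v τ → Context τ × TableAt v 0 (nreg τ count) τ)
        (λ ()) σ0 (n≤[1+n]^1 n) (λ _ _ _ inv → inv)
        (context , table-start n l0 o0 s0)
        row))
      where
      row : ∀ v τ → v ℕ.< n → nreg τ outer ≡ v → nreg τ numDisks ≡ n →
        Context τ × TableAt v 0 (nreg τ count) τ →
        Terminates n (old ≔ⁿ reg count ⨾ for inner below numDisks loop search)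
          (λ υ → nreg υ outer ≡ v × nreg υ numDisks ≡ n × Context υ × TableAt (suc v) 0 (nreg υ count) υ) τ
      row v τ v<n τo τ0 (context , T) = ≔ⁿ⨾-rule (consequence
        (λ (υ0 , υo , _ , context , T) → υo , υ0 , context , table-begin-row n v<n T)
        (for-rule n (λ b → Row v b (nreg τ count)) (λ ()) τ0 (n≤[1+n]^1 n) (λ _ _ _ inv → inv)
          (τo , refl , context , T)
          λ b υ b<n υi υ0 inv → search-correct b υ v<n b<n υi υ0 inv))

    record Extracted (sel : ℕ → ℕ) : Set where
      field
        {end₁ end₂}    : ℕ
        positions   : List ℕ
        chains      : ChainPair end₁ end₂ positions
        end≤n       : end₁ ℕ.≤ n
        maximal     : ∀ {a c L} → ChainPair a c L → a ℕ.≤ n → length L ℕ.≤ length positions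
        selected    : ∀ {x} → x ∈ positions → sel (ord x) ≡ 1
        onlyThese   : ∀ {u} → sel u ≡ 1 → ∃[ x ] x ∈ positions × u ≡ ord x

    extract-correct : ∀ {σ} → nreg σ numDisks ≡ n → Context σ → TableAt n 0 (nreg σ count) σ →
      Terminates n extract (λ τ → Extracted (narr τ chosen)) σ
    extract-correct {σ} σ0 (ρ≡ , ord≡ , _ , chosen≡) T with sound T (top<m T)
    ... | L , path , pair , z≡ = ≔ⁿ⨾-rule (consequence (λ {τ} → finish τ)
        (for-rule (length L) Inv (λ ()) z≡
          (ℕ.≤-trans (length≤last pair) (ℕ.≤-trans (oldLast T (top<m T)) n≤²))
          (λ _ _ _ inv → inv)
          (ord≡ , refl , refl , L , ℕ.+-identityʳ _ , path , (λ x∈L → x∈L) , inj₁ ,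
            λ {u} eq → contradiction (trans (sym (cong (λ f → f u) chosen≡)) eq) λ ())
          body))
      where
      h = narr σ last
      p = narr σ pred
      m = nreg σ count
      n≤² : n ℕ.≤ suc n ℕ.^ 2
      n≤² = ℕ.≤-trans (n≤[1+n]^1 n) (ℕ.^-monoʳ-≤ (suc n) {1} {2} (s≤s z≤n))

      -- `rest` is the unvisited part of the list of the best row. It loses one element per round,
      -- so after `length L` rounds it is empty and every element is marked.
      Inv : ℕ → State → Set
      Inv k τ = narr τ order ≡ ord × narr τ last ≡ h × narr τ pred ≡ p × ∃[ rest ]
        length rest ℕ.+ k ≡ length L × Path m h p (nreg τ best) rest ×
        (∀ {x} → x ∈ rest → x ∈ L) ×
        (∀ {x} → x ∈ L → x ∈ rest ⊎ narr τ chosen (ord x) ≡ 1) ×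
        (∀ {u} → narr τ chosen u ≡ 1 → ∃[ x ] x ∈ L × u ≡ ord x)

      finish : ∀ τ → nreg τ steps ≡ length L × Inv (length L) τ → Extracted (narr τ chosen)
      finish τ (_ , _ , _ , _ , [] , _ , _ , _ , marked , only) = record
        { positions = L
        ; chains    = pair
        ; end≤n     = oldLast T (top<m T)
        -- At `v = n` completeness of the table speaks of all pairs of chains, and the best row is
        -- at least as long as any row.
        ; maximal   = λ c a≤n → let s , s<m , _ , _ , len = oldComplete T c a≤n in
            ℕ.≤-trans len (ℕ.≤-trans (topMax T s<m) (ℕ.≤-reflexive z≡))
        ; selected  = λ x∈L → [ (λ ()) , (λ eq → eq) ]′ (marked x∈L)
        ; onlyThese = only
        }
      finish τ (_ , _ , _ , _ , _ ∷ rest , eq , _) =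
        contradiction eq (ℕ.<⇒≢ (s≤s (ℕ.m≤n+m (length L) (length rest))) ∘ sym)

      body : ∀ k τ → k ℕ.< length L → nreg τ outer ≡ k → nreg τ steps ≡ length L → Inv k τ →
        Terminates n (chosen [ arr order (arr last (reg best) ⊖ lit 1) ]≔ⁿ lit 1 ⨾ best ≔ⁿ arr pred (reg best))
          (λ υ → nreg υ outer ≡ k × nreg υ steps ≡ length L × Inv (suc k) υ) τ
      body k τ k<len τo τs (_ , _ , _ , [] , eq , _) = contradiction eq (ℕ.<⇒≢ k<len)
      body k τ k<len τo τs (ord≡ , h≡ , p≡ , x ∷ rest , eq , (_ , hs≡ , path) , sub , marked , only) =
        []≔ⁿ⨾-rule (≔ⁿ-rule (τo , τs , ord≡ , h≡ , p≡ , rest ,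
          trans (ℕ.+-suc (length rest) k) eq ,
          subst (λ f → Path m h p (f (nreg τ best)) rest) (sym p≡) path ,
          sub ∘ there ,
          subst (λ c → ∀ {y} → y ∈ L → y ∈ rest ⊎ update (narr τ chosen) c 1 (ord y) ≡ 1) (sym cell≡) marked′ ,
          subst (λ c → ∀ {u} → update (narr τ chosen) c 1 u ≡ 1 → ∃[ y ] y ∈ L × u ≡ ord y) (sym cell≡) only′))
        where
        cell≡ : narr τ order (narr τ last (nreg τ best) ℕ.∸ 1) ≡ ord x
        cell≡ = cong₂ (λ f y → f (y ℕ.∸ 1)) ord≡ (trans (cong (λ f → f (nreg τ best)) h≡) hs≡)
        marked′ : ∀ {y} → y ∈ L → y ∈ rest ⊎ update (narr τ chosen) (ord x) 1 (ord y) ≡ 1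
        marked′ {y} y∈L with ord y ℕ.≟ ord x
        ... | yes _ = inj₂ refl
        ... | no ≢ with marked y∈L
        ...   | inj₁ (here refl) = contradiction refl ≢
        ...   | inj₁ (there y∈)  = inj₁ y∈
        ...   | inj₂ one         = inj₂ one
        only′ : ∀ {u} → update (narr τ chosen) (ord x) 1 u ≡ 1 → ∃[ y ] y ∈ L × u ≡ ord y
        only′ {u} one with u ℕ.≟ ord x
        ... | yes refl = x , sub (here refl) , refl
        ... | no _     = only one

-- The approximation ratio

-- Induction on the subset: passing to its tail turns `f` into `pred ∘ f`, and the element covering
-- vertex 0 is deleted from the list. Its value being 0, it covers no other vertex.
∣∣≤length : ∀ {A : Set} {n} (M : Subset n) (f : A → ℕ) (L : List A) →
  (∀ {i} → i Subset.∈ M → ∃[ x ] x ∈ L × f x ≡ toℕ i) → ∣ M ∣ ℕ.≤ length L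
∣∣≤length []            f L cover = z≤n
∣∣≤length (outside ∷ M) f L cover = ∣∣≤length M (ℕ.pred ∘ f) L
  λ i∈M → let x , x∈L , eq = cover (there i∈M) in x , x∈L , cong ℕ.pred eq
∣∣≤length (inside ∷ M) f L cover with cover here
... | x , x∈L , fx≡0 with ∈-∃++ x∈L
...   | ys , zs , refl = subst (suc ∣ M ∣ ℕ.≤_) (sym eq-length) (s≤s (∣∣≤length M (ℕ.pred ∘ f) (ys ++ zs) cover′))
  where
  eq-length : length (ys ++ x ∷ zs) ≡ suc (length (ys ++ zs))
  eq-length = trans (length-++ ys) (trans (ℕ.+-suc _ _) (cong suc (sym (length-++ ys))))
  cover′ : ∀ {i} → i Subset.∈ M → ∃[ y ] y ∈ ys ++ zs × ℕ.pred (f y) ≡ toℕ i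
  cover′ i∈M with cover (there i∈M)
  ... | y , y∈L , eq with ∈-++⁻ ys y∈L
  ...   | inj₁ y∈ys         = y , ∈-++⁺ˡ y∈ys , cong ℕ.pred eq
  ...   | inj₂ (here refl)  = contradiction (trans (sym fx≡0) eq) λ ()
  ...   | inj₂ (there y∈zs) = y , ∈-++⁺ʳ ys y∈zs , cong ℕ.pred eq

-- Induction on the list: the vertex of the head is deleted from `S`, and distinctness keeps the
-- others in it.
length≤∣∣ : ∀ {A : Set} {n} (S : Subset n) (f : A → ℕ) {L : List A} →
  AllPairs (λ x y → f x ≢ f y) L →
  (∀ {x} → x ∈ L → ∃[ i ] toℕ i ≡ f x × i Subset.∈ S) → length L ℕ.≤ ∣ S ∣
length≤∣∣ S f []                 inS = z≤n
length≤∣∣ S f (_∷_ {x} x≢ distinct) inS with inS (here refl)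
... | i , i≡ , i∈S = ℕ.≤-<-trans
  (length≤∣∣ (S Subset.- i) f distinct λ y∈L →
    let j , j≡ , j∈S = inS (there y∈L) in
    j , j≡ , Subset.x∈p∧x≢y⇒x∈p-y j∈S
      λ { refl → All.lookup x≢ y∈L (trans (sym i≡) j≡) })
  (Subset.x∈p⇒∣p-x∣<∣p∣ i∈S)

AllPairs-lookup : ∀ {A : Set} {R : A → A → Set} {L x y} → AllPairs R L →
  x ∈ L → y ∈ L → x ≢ y → R x y ⊎ R y x
AllPairs-lookup (rs ∷ _) (here refl) (here refl) x≢x = contradiction refl x≢x
AllPairs-lookup (rs ∷ _) (here refl) (there y∈)  _   = inj₁ (All.lookup rs y∈)
AllPairs-lookup (rs ∷ _) (there x∈)  (here refl) _   = inj₂ (All.lookup rs x∈)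
AllPairs-lookup (_ ∷ ps) (there x∈)  (there y∈)  x≢y = AllPairs-lookup ps x∈ y∈ x≢y

-- The order by strip and then by x-coordinate

module StripOrder (ℝ : Reals) (ST : ℕ → ℕ) (X : ℕ → Reals.Carrier ℝ) where
  private module R = Reals ℝ
  open OrderedField ℝ

  _⊑_ : ℕ → ℕ → Bool
  u ⊑ w = not (does (ST w ℕ.≤? ST u)) or (does (ST w ℕ.≟ ST u) ∧ does (X u R.≤? X w))

  LexLeq : ℕ → ℕ → Set
  LexLeq u w = ST u ℕ.< ST w ⊎ ST u ≡ ST w × X u R.≤ X w

  ⊑⇒lex : ∀ {u w} → u ⊑ w ≡ true → LexLeq u w
  ⊑⇒lex {u} {w} eq with or-true {not (does (ST w ℕ.≤? ST u))} eq
  ... | inj₁ lt = inj₁ (ℕ.≰⇒> (does-false (ST w ℕ.≤? ST u) (not-true lt)))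
  ... | inj₂ both with ∧-true both
  ...   | st , x = inj₂ (sym (does-true (ST w ℕ.≟ ST u) st) , does-true (X u R.≤? X w) x)

  lex⇒⊑ : ∀ {u w} → LexLeq u w → u ⊑ w ≡ true
  lex⇒⊑ {u} {w} (inj₁ lt)       = or-left (cong not (dec-false (ST w ℕ.≤? ST u) (ℕ.<⇒≱ lt)))
  lex⇒⊑ {u} {w} (inj₂ (st , x)) = or-right {not (does (ST w ℕ.≤? ST u))}
    (∧-intro (dec-true (ST w ℕ.≟ ST u) (sym st)) (dec-true (X u R.≤? X w) x))

  ⊑-total : ∀ {u w} → u ⊑ w ≡ false → w ⊑ u ≡ true
  ⊑-total {u} {w} eq with ℕ.<-cmp (ST u) (ST w)
  ... | tri< lt _ _ = contradiction (trans (sym eq) (lex⇒⊑ {u} {w} (inj₁ lt))) λ ()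
  ... | tri> _ _ gt = lex⇒⊑ {w} {u} (inj₁ gt)
  ... | tri≈ _ st _ with total (X u) (X w)
  ...   | inj₁ u≤w = contradiction (trans (sym eq) (lex⇒⊑ {u} {w} (inj₂ (st , u≤w)))) λ ()
  ...   | inj₂ w≤u = lex⇒⊑ {w} {u} (inj₂ (sym st , w≤u))

  ⊑-trans : ∀ {u v w} → u ⊑ v ≡ true → v ⊑ w ≡ true → u ⊑ w ≡ true
  ⊑-trans {u} {v} {w} p q = lex⇒⊑ {u} {w} (lex (⊑⇒lex {u} {v} p) (⊑⇒lex {v} {w} q))
    where
    lex : LexLeq u v → LexLeq v w → LexLeq u w
    lex (inj₁ lt)       (inj₁ lt′)      = inj₁ (ℕ.<-trans lt lt′)
    lex (inj₁ lt)       (inj₂ (st , _)) = inj₁ (subst (ST u ℕ.<_) st lt)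
    lex (inj₂ (st , _)) (inj₁ lt)       = inj₁ (subst (ℕ._< ST w) (sym st) lt)
    lex (inj₂ (st , x)) (inj₂ (st′ , x′)) = inj₂ (trans st st′ , ≤-trans x x′)

-- Transitivity of the chain relation and the chains behind a row

module Chains (ℝ : Reals) (n : ℕ) (ρ : Name → ℕ → Reals.Carrier ℝ) (ord ST CL : ℕ → ℕ)
  (perm : Permutation n ord)
  (separated : ∀ {u w} → u ℕ.< n → w ℕ.< n → Strips.Separated ℝ n (ρ xs) (ρ ys) ST CL u w)
  (sorted : ∀ p q → p ℕ.< n → p ℕ.< q → q ℕ.< n →
            StripOrder._⊑_ ℝ ST (ρ xs) (ord p) (ord q) ≡ true)
  where
  open RealRAM ℝ
  private module R = Reals ℝ
  open OrderedField ℝ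
  open Building ℝ
  open Permutation perm
  open StripOrder ℝ ST (ρ xs) using (LexLeq; ⊑⇒lex)

  position : ℕ → Point
  position u = point (ρ xs u) (ρ ys u)

  Near : ℕ → ℕ → Set
  Near u w = dist² (position u) (position w) R.≤ four

  Near-sym : ∀ {u w} → Near u w → Near w u
  Near-sym {u} {w} = ≤-respˡ-≈ (dist²-comm (position u) (position w))

  near? : ∀ u w → Dec (Near u w)
  near? u w = dist² (position u) (position w) R.≤? four

  extends : ℕ → ℕ → Bool
  extends = continuesᵇ ρ ord CL

  open ChainPairs extends

  _≺_ : ℕ → ℕ → Set
  p ≺ v = CL (ord p) ≡ CL (ord v) × ¬ Near (ord p) (ord v)

  extends⇒≺ : ∀ {p v} → extends (suc p) v ≡ true → p ≺ v
  extends⇒≺ {p} {v} eq with or-true {false} eq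
  ... | inj₂ both with ∧-true both
  ...   | cl , far = does-true (CL (ord p) ℕ.≟ CL (ord v)) cl ,
                     does-false (near? (ord p) (ord v)) (not-true far)

  ≺⇒extends : ∀ {p v} → p ≺ v → extends (suc p) v ≡ true
  ≺⇒extends {p} {v} (cl , far) = or-right {false}
    (∧-intro (dec-true (CL (ord p) ℕ.≟ CL (ord v)) cl)
             (cong not (dec-false (near? (ord p) (ord v)) far)))

  lex : ∀ {p q} → p ℕ.< q → q ℕ.< n → LexLeq (ord p) (ord q)
  lex p<q q<n = ⊑⇒lex (sorted _ _ (ℕ.<-trans p<q q<n) p<q q<n)

  open Strips ℝ n (ρ xs) (ρ ys) using (z; module Separated)
  open Separated

  private
    Δ : (ℕ → R.Carrier) → ℕ → ℕ → R.Carrier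
    Δ f u w = f w R.- f u

    dist²-Δ : ∀ u w → dist² (position u) (position w) R.≈
      Δ (ρ xs) u w R.* Δ (ρ xs) u w R.+ Δ (ρ ys) u w R.* Δ (ρ ys) u w
    dist²-Δ u w = dist²-comm (position u) (position w)

  different-strips : ∀ {u w} → u ℕ.< n → w ℕ.< n → ST u ℕ.< ST w → CL u ≡ CL w → ¬ Near u w
  different-strips {u} {w} u<n w<n st cl = tall 6≤2Δ ∘ ≤-respˡ-≈ (dist²-Δ u w)
    where
    6≤2Δ : three R.+ three R.≤ Δ (ρ ys) u w R.+ Δ (ρ ys) u w
    6≤2Δ = 0≤y-x⇒x≤y (≤-respʳ-≈
      (solve 3 (λ a b t → b :+ b :- (a :+ a :+ t :+ t) := (b :- a :+ (b :- a)) :- (t :+ t))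
        R.refl (ρ ys u) (ρ ys w) three)
      (x≤y⇒0≤y-x (same-class (separated u<n w<n) st cl)))

  -- `same-strip` bounds the difference of heights from one side; applying it to both orders of the
  -- pair bounds the absolute value.
  slope : ∀ {u w} → u ℕ.< n → w ℕ.< n → ST u ≡ ST w →
    Δ (ρ ys) u w R.+ Δ (ρ ys) u w R.≤ three × R.- Δ (ρ ys) u w R.+ R.- Δ (ρ ys) u w R.≤ three
  slope {u} {w} u<n w<n st =
    0≤y-x⇒x≤y (≤-respʳ-≈
      (solve 3 (λ a b t → a :+ a :+ t :- (b :+ b) := t :- (b :- a :+ (b :- a)))
        R.refl (ρ ys u) (ρ ys w) three)
      (x≤y⇒0≤y-x (same-strip (separated w<n u<n) (sym st)))) ,
    0≤y-x⇒x≤y (≤-respʳ-≈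
      (solve 3 (λ a b t → b :+ b :+ t :- (a :+ a) := t :- (:- (b :- a) :+ :- (b :- a)))
        R.refl (ρ ys u) (ρ ys w) three)
      (x≤y⇒0≤y-x (same-strip (separated u<n w<n) st)))

  -- If either step changes strip, the outer strips differ and their equal classes alone keep the
  -- disks apart. Otherwise all three centres share a strip, sorting makes both horizontal offsets
  -- nonnegative, and `strip-transitive` applies.
  ≺-trans : ∀ {p q v} → p ℕ.< q → q ℕ.< v → v ℕ.< n → p ≺ q → q ≺ v → p ≺ v
  ≺-trans {p} {q} {v} p<q q<v v<n (cl₁ , far₁) (cl₂ , far₂) =
    trans cl₁ cl₂ , far (lex p<q q<n) (lex q<v v<n)
    where
    q<n = ℕ.<-trans q<v v<n
    up = bounded (ℕ.<-trans p<q q<n)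
    uq = bounded q<n
    uv = bounded v<n
    X = ρ xs
    far : LexLeq (ord p) (ord q) → LexLeq (ord q) (ord v) → ¬ Near (ord p) (ord v)
    far (inj₁ lt)       (inj₁ lt′)       = different-strips up uv (ℕ.<-trans lt lt′) (trans cl₁ cl₂)
    far (inj₁ lt)       (inj₂ (st , _))  = different-strips up uv (subst (ST (ord p) ℕ.<_) st lt) (trans cl₁ cl₂)
    far (inj₂ (st , _)) (inj₁ lt) =
      different-strips up uv (subst (ℕ._< ST (ord v)) (sym st) lt) (trans cl₁ cl₂)
    far (inj₂ (st , x)) (inj₂ (st′ , x′)) =
      strip-transitive (x≤y⇒0≤y-x x) (x≤y⇒0≤y-x x′)
        (proj₁ s₁) (proj₂ s₁) (proj₁ s₂) (proj₂ s₂)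
        (far₁ ∘ ≤-respˡ-≈ (R.sym (dist²-Δ (ord p) (ord q))))
        (far₂ ∘ ≤-respˡ-≈ (R.sym (dist²-Δ (ord q) (ord v))))
        (Δ (ρ ys) (ord p) (ord v)) ∘
      ≤-respˡ-≈ (R.trans (dist²-Δ (ord p) (ord v)) (R.+-congʳ (R.*-cong sum sum)))
      where
      s₁ = slope up uq st
      s₂ = slope uq uv st′
      sum : Δ X (ord p) (ord v) R.≈ Δ X (ord p) (ord q) R.+ Δ X (ord q) (ord v)
      sum = solve 3 (λ a b c → c :- a := b :- a :+ (c :- b)) R.refl (X (ord p)) (X (ord q)) (X (ord v))

  top : List ℕ → ℕ
  top []      = 0
  top (x ∷ _) = suc x

  _≻_ : ℕ → ℕ → Set
  v ≻ p = p ℕ.< v × p ≺ v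

  -- The program compares `v` with the end of the chain only; transitivity carries the result to all
  -- other members.
  chain-extend : ∀ {A v} → AllPairs _≻_ A → v ℕ.< n → top A ℕ.≤ v → extends (top A) v ≡ true →
    AllPairs _≻_ (v ∷ A)
  chain-extend []       _ _ _ = [] ∷ []
  chain-extend (_∷_ {x} x≻ chain) v<n x<v okᵇ =
    ((x<v , extends⇒≺ okᵇ) ∷
     All.map (λ (y<x , y≺x) → ℕ.<-trans y<x x<v , ≺-trans y<x x<v v<n y≺x (extends⇒≺ okᵇ)) x≻)
    ∷ x≻ ∷ chain

  record Split (a c : ℕ) (L : List ℕ) : Set where
    field
      {A B}  : List ℕ
      chainA : AllPairs _≻_ A
      chainB : AllPairs _≻_ B
      split  : ∀ {x} → x ∈ L → x ∈ A ⊎ x ∈ B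
      ends   : a ≡ top A × c ≡ top B

  swap-split : ∀ {a c L} → Split a c L → Split c a L
  swap-split s = record
    { chainA = chainB ; chainB = chainA
    ; split  = [ inj₂ , inj₁ ]′ ∘ split
    ; ends   = proj₂ ends , proj₁ ends }
    where open Split s

  split-extend : ∀ {a c v L} → Split a c L → v ℕ.< n → a ℕ.≤ v → extends a v ≡ true →
    Split (suc v) c (v ∷ L)
  split-extend {v = v} s v<n a≤v okᵇ = record
    { chainA = chain-extend chainA v<n (subst (ℕ._≤ v) (proj₁ ends) a≤v)
                 (subst (λ t → extends t v ≡ true) (proj₁ ends) okᵇ)
    ; chainB = chainB
    ; split  = λ { (here refl) → inj₁ (here refl)
                 ; (there x∈L) → [ inj₁ ∘ there , inj₂ ]′ (split x∈L) }
    ; ends   = refl , proj₂ ends }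
    where open Split s

  chainPair-split : ∀ {a c L} → ChainPair a c L → a ℕ.≤ n → Split a c L
  chainPair-split empty _ = record { chainA = [] ; chainB = [] ; split = λ () ; ends = refl , refl }
  chainPair-split (onLast c p≤v okᵇ) v<n =
    split-extend (chainPair-split c (ℕ.≤-trans p≤v (ℕ.<⇒≤ v<n))) v<n p≤v okᵇ
  chainPair-split (onOther c p≤v okᵇ) v<n =
    split-extend (swap-split (chainPair-split c (ℕ.≤-trans p≤v (ℕ.<⇒≤ v<n)))) v<n
      (ℕ.≤-trans (other≤last c) p≤v) okᵇ

  below-last : ∀ {a c L} → ChainPair a c L → All (ℕ._< a) L
  below-last empty = []
  below-last (onLast c p≤v _)  = ℕ.≤-refl ∷ All.map (λ x<p → ℕ.m<n⇒m<1+n (ℕ.<-≤-trans x<p p≤v)) (below-last c)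
  below-last (onOther c p≤v _) = ℕ.≤-refl ∷ All.map (λ x<p → ℕ.m<n⇒m<1+n (ℕ.<-≤-trans x<p p≤v)) (below-last c)

  vertex-fresh : ∀ {p q L v} → ChainPair p q L → p ℕ.≤ v → v ℕ.< n → All (λ y → ord v ≢ ord y) L
  vertex-fresh c p≤v v<n = All.map (λ y<p eq → let y<v = ℕ.<-≤-trans y<p p≤v in
    ℕ.<⇒≢ y<v (sym (injective v<n (ℕ.<-trans y<v v<n) eq))) (below-last c)

  distinct-vertices : ∀ {a c L} → ChainPair a c L → a ℕ.≤ n → AllPairs (λ x y → ord x ≢ ord y) L
  distinct-vertices empty _ = []
  distinct-vertices (onLast c p≤v _)  v<n =
    vertex-fresh c p≤v v<n ∷ distinct-vertices c (ℕ.≤-trans p≤v (ℕ.<⇒≤ v<n))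
  distinct-vertices (onOther c p≤v _) v<n =
    vertex-fresh c p≤v v<n ∷ distinct-vertices c (ℕ.≤-trans p≤v (ℕ.<⇒≤ v<n))

-- The extracted set against an arbitrary induced bipartite subgraph

module Approximation (ℝ : Reals)
  (n : ℕ) (D : Fin n → Plane.UnitDisk ℝ) (ρ : Name → ℕ → Reals.Carrier ℝ)
  (xs≡ : ∀ i → ρ xs (toℕ i) ≡ Plane.xcoord (Plane.centre (D i)))
  (ys≡ : ∀ i → ρ ys (toℕ i) ≡ Plane.ycoord (Plane.centre (D i)))
  (ord ST CL : ℕ → ℕ)
  (perm : Permutation n ord)
  (separated : ∀ {u w} → u ℕ.< n → w ℕ.< n → Strips.Separated ℝ n (ρ xs) (ρ ys) ST CL u w)
  (sorted : ∀ p q → p ℕ.< n → p ℕ.< q → q ℕ.< n →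
            StripOrder._⊑_ ℝ ST (ρ xs) (ord p) (ord q) ≡ true)
  (class-mod3 : ∀ {u} → u ℕ.< n → ∃[ k ] CL u ≡ mod3 k)
  (sel : ℕ → ℕ) (extracted : Building.Extracted ℝ n ρ ord CL sel)
  where
  open RealRAM ℝ
  private module R = Reals ℝ
  open OrderedField ℝ
  open Chains ℝ n ρ ord ST CL perm separated sorted
  open ChainPairs (Building.continuesᵇ ℝ ρ ord CL)
  open Permutation perm
  open Building.Extracted extracted
  open Split (chainPair-split chains end≤n)

  G : Graph (Fin n)
  G = intersectionGraph D

  position≡centre : ∀ i → position (toℕ i) ≡ centre (D i)
  position≡centre i = cong₂ point (xs≡ i) (ys≡ i)

  intersect⇒Near : ∀ {i j} → Intersect (D i) (D j) → Near (toℕ i) (toℕ j)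
  intersect⇒Near {i} {j} = subst₂ (λ p q → dist² p q R.≤ four)
    (sym (position≡centre i)) (sym (position≡centre j)) ∘ intersect⇒near

  Near⇒intersect : ∀ {i j} → Near (toℕ i) (toℕ j) → Intersect (D i) (D j)
  Near⇒intersect {i} {j} = near⇒intersect ∘ subst₂ (λ p q → dist² p q R.≤ four)
    (position≡centre i) (position≡centre j)

  S : Subset n
  S = tabulate (λ i → does (sel (toℕ i) ℕ.≟ 1))

  ∈S⇒ : ∀ {i} → i Subset.∈ S → ∃[ x ] x ∈ positions × toℕ i ≡ ord x
  ∈S⇒ {i} i∈S = onlyThese (does-true (sel (toℕ i) ℕ.≟ 1)
    (trans (sym (lookup∘tabulate _ i)) ([]=⇒lookup i∈S)))

  S⇐ : ∀ {x} → x ∈ positions → ∃[ i ] toℕ i ≡ ord x × i Subset.∈ S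
  S⇐ {x} x∈ = i , i≡ , lookup⇒[]= i S (trans (lookup∘tabulate _ i)
      (dec-true (sel (toℕ i) ℕ.≟ 1) (trans (cong sel i≡) (selected x∈))))
    where
    ord-x<n : ord x ℕ.< n
    ord-x<n = bounded (ℕ.<-≤-trans (All.lookup (below-last chains) x∈) end≤n)
    i = fromℕ< ord-x<n
    i≡ = Fin.toℕ-fromℕ< ord-x<n

  positions≤S : length positions ℕ.≤ ∣ S ∣
  positions≤S = length≤∣∣ S ord (distinct-vertices chains end≤n) S⇐

  chain-independent : ∀ {A x y i j} → AllPairs _≻_ A → x ∈ A → y ∈ A →
    toℕ i ≡ ord x → toℕ j ≡ ord y → ¬ Graph.Adj G i j
  chain-independent {x = x} {y} {i} {j} chain x∈A y∈A i≡ j≡ (i≢j , meet) =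
    [ (λ (_ , _ , far) → far (Near-sym {ord x} {ord y} near-xy)) , (λ (_ , _ , far) → far near-xy) ]′
      (AllPairs-lookup chain x∈A y∈A λ { refl → i≢j (Fin.toℕ-injective (trans i≡ (sym j≡))) })
    where
    near-xy : Near (ord x) (ord y)
    near-xy = subst₂ Near i≡ j≡ (intersect⇒Near {i} {j} meet)

  bipartite : InducesBipartite G S
  bipartite = side , differ
    where
    side : ∃[ i ] i Subset.∈ S → Bool
    side (i , i∈S) = does (proj₁ (∈S⇒ i∈S) ∈? A)
    otherwise : ∀ {x} → x ∈ positions → ¬ (x ∈ A) → x ∈ B
    otherwise x∈ x∉A = [ (λ x∈A → contradiction x∈A x∉A) , (λ x∈B → x∈B) ]′ (split x∈)
    differ : ∀ u w → Graph.Adj (induced G (Subset._∈ S)) u w → side u ≢ side w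
    differ (i , i∈S) (j , j∈S) adj with ∈S⇒ i∈S | ∈S⇒ j∈S
    ... | x , x∈ , i≡ | y , y∈ , j≡ with x ∈? A | y ∈? A
    ...   | yes x∈A | yes y∈A = contradiction adj (chain-independent chainA x∈A y∈A i≡ j≡)
    ...   | yes _   | no _    = λ ()
    ...   | no _    | yes _   = λ ()
    ...   | no x∉A  | no y∉A  = contradiction adj
      (chain-independent chainB (otherwise x∈ x∉A) (otherwise y∈ y∉A) i≡ j≡)

  module _ (M : Subset n) (bip : InducesBipartite G M) where

    -- The given colouring takes a membership proof and might depend on it; deciding membership
    -- fixes one proof per vertex. Outside `M` the value is a default.
    colour : Fin n → Bool
    colour i with i Subset.∈? M
    ... | yes i∈M = proj₁ bip (i , i∈M)
    ... | no _    = false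

    colour-differ : ∀ {i j} → i Subset.∈ M → j Subset.∈ M → Graph.Adj G i j → colour i ≢ colour j
    colour-differ {i} {j} i∈M j∈M adj with i Subset.∈? M | j Subset.∈? M
    ... | yes p | yes q = proj₂ bip (i , p) (j , q) adj
    ... | no i∉M | _    = contradiction i∈M i∉M
    ... | _ | no j∉M    = contradiction j∈M j∉M

    module _ (r : ℕ) where

      At : ℕ → Fin n → Set
      At x i = ord x ≡ toℕ i × i Subset.∈ M × CL (ord x) ≡ r

      EndOf : Bool → ℕ → Set
      EndOf s a = a ≡ 0 ⊎ ∃[ x ] ∃[ i ] a ≡ suc x × At x i × colour i ≡ s

      -- Two vertices of `M` with equal colours are not adjacent, so their centres are not near, and
      -- both have class `r`.
      end-extends : ∀ {s a t i} → EndOf s a → a ℕ.≤ t → t ℕ.< n → At t i → colour i ≡ s →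
        extends a t ≡ true
      end-extends (inj₁ refl) _ _ _ _ = refl
      end-extends {t = t} {i} (inj₂ (x , j , refl , (j≡ , j∈M , clⱼ) , sⱼ)) x<t t<n (i≡ , i∈M , clᵢ) sᵢ =
        ≺⇒extends (trans clⱼ (sym clᵢ) , λ near-jt →
          colour-differ j∈M i∈M (j≢i , Near⇒intersect {j} {i} (subst₂ Near j≡ i≡ near-jt)) (trans sⱼ (sym sᵢ)))
        where
        j≢i : j ≢ i
        j≢i refl = ℕ.<⇒≢ x<t (injective (ℕ.<-trans x<t t<n) t<n (trans j≡ (sym i≡)))

      -- A scan of the positions below `t` puts the vertices of `M` in class `r` on two chains, one
      -- per colour. `pair` allows both orders because a `ChainPair` names the later end first, and
      -- either colour may own it.
      record Track (t : ℕ) : Set where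
        field
          {ends₁ ends₂} : ℕ
          {members}     : List ℕ
          pair    : ChainPair ends₁ ends₂ members ⊎ ChainPair ends₂ ends₁ members
          end₁-ok : EndOf true ends₁
          end₂-ok : EndOf false ends₂
          ≤t      : ends₁ ℕ.≤ t × ends₂ ℕ.≤ t
          covers  : ∀ {x i} → x ℕ.< t → At x i → x ∈ members
      open Track

      extend-pair : ∀ {a c L t} → ChainPair a c L ⊎ ChainPair c a L → a ℕ.≤ t → c ℕ.≤ t →
        extends a t ≡ true → ChainPair (suc t) c (t ∷ L)
      extend-pair (inj₁ p) a≤t _ okᵇ = onLast p a≤t okᵇ
      extend-pair (inj₂ p) _ c≤t okᵇ = onOther p c≤t okᵇ

      track-skip : ∀ {t} → Track t → (∀ {i} → ¬ At t i) → Track (suc t)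
      track-skip {t} T none = record
        { pair    = pair T
        ; end₁-ok = end₁-ok T
        ; end₂-ok = end₂-ok T
        ; ≤t      = ℕ.m≤n⇒m≤1+n (proj₁ (≤t T)) , ℕ.m≤n⇒m≤1+n (proj₂ (≤t T))
        ; covers  = cover
        }
        where
        cover : ∀ {x i} → x ℕ.< suc t → At x i → x ∈ members T
        cover {x} x<1+t at with x ℕ.≟ t
        ... | yes refl = contradiction at none
        ... | no x≢t   = covers T (ℕ.≤∧≢⇒< (ℕ.≤-pred x<1+t) x≢t) at

      track-extend : ∀ {t i} → Track t → t ℕ.< n → At t i → Track (suc t)
      track-extend {t} {i} T t<n at = by-colour (colour i) refl
        where
        cover : ∀ {x j} → x ℕ.< suc t → At x j → x ∈ t ∷ members T
        cover {x} x<1+t at with x ℕ.≟ t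
        ... | yes refl = here refl
        ... | no x≢t   = there (covers T (ℕ.≤∧≢⇒< (ℕ.≤-pred x<1+t) x≢t) at)
        by-colour : ∀ s → colour i ≡ s → Track (suc t)
        by-colour true c≡ = record
          { pair    = inj₁ (extend-pair (pair T) (proj₁ (≤t T)) (proj₂ (≤t T))
                        (end-extends (end₁-ok T) (proj₁ (≤t T)) t<n at c≡))
          ; end₁-ok = inj₂ (t , i , refl , at , c≡)
          ; end₂-ok = end₂-ok T
          ; ≤t      = ℕ.≤-refl , ℕ.m≤n⇒m≤1+n (proj₂ (≤t T))
          ; covers  = cover
          }
        by-colour false c≡ = record
          { pair    = inj₂ (extend-pair ([ inj₂ , inj₁ ]′ (pair T)) (proj₂ (≤t T)) (proj₁ (≤t T))
                        (end-extends (end₂-ok T) (proj₂ (≤t T)) t<n at c≡))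
          ; end₁-ok = end₁-ok T
          ; end₂-ok = inj₂ (t , i , refl , at , c≡)
          ; ≤t      = ℕ.m≤n⇒m≤1+n (proj₁ (≤t T)) , ℕ.≤-refl
          ; covers  = cover
          }

      track : ∀ t → t ℕ.≤ n → Track t
      track zero _ = record
        { pair = inj₁ empty ; end₁-ok = inj₁ refl ; end₂-ok = inj₁ refl ; ≤t = z≤n , z≤n ; covers = λ () }
      track (suc t) t<n with track t (ℕ.<⇒≤ t<n) | fromℕ< (bounded t<n) Subset.∈? M | CL (ord t) ℕ.≟ r
      ... | T | yes i∈M | yes cl = track-extend T t<n (sym (Fin.toℕ-fromℕ< (bounded t<n)) , i∈M , cl)
      ... | T | yes _   | no ¬cl = track-skip T λ (_ , _ , cl) → ¬cl cl
      ... | T | no i∉M  | _      = track-skip T λ (i≡ , i∈M , _) → i∉M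
        (subst (Subset._∈ M) (Fin.toℕ-injective (trans (sym i≡) (sym (Fin.toℕ-fromℕ< (bounded t<n))))) i∈M)

      class-members : ∃[ L ] length L ℕ.≤ length positions × (∀ {x i} → x ℕ.< n → At x i → x ∈ L)
      class-members = members T , len (pair T) , covers T
        where
        T = track n ℕ.≤-refl
        len : ChainPair (ends₁ T) (ends₂ T) (members T) ⊎ ChainPair (ends₂ T) (ends₁ T) (members T) →
          length (members T) ℕ.≤ length positions
        len (inj₁ p) = maximal p (proj₁ (≤t T))
        len (inj₂ p) = maximal p (proj₂ (≤t T))

    ∣M∣≤3∣S∣ : ∣ M ∣ ℕ.≤ 3 ℕ.* ∣ S ∣
    ∣M∣≤3∣S∣ = begin
      ∣ M ∣
        ≤⟨ ∣∣≤length M ord (L₀ ++ L₁ ++ L₂) cover ⟩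
      length (L₀ ++ L₁ ++ L₂)
        ≡⟨ length-++ L₀ ⟩
      length L₀ ℕ.+ length (L₁ ++ L₂)
        ≡⟨ cong (length L₀ ℕ.+_) (length-++ L₁) ⟩
      length L₀ ℕ.+ (length L₁ ℕ.+ length L₂)
        ≤⟨ ℕ.+-mono-≤ (short 0) (ℕ.+-mono-≤ (short 1) (short 2)) ⟩
      ∣ S ∣ ℕ.+ (∣ S ∣ ℕ.+ ∣ S ∣)
        ≡⟨ cong (λ k → ∣ S ∣ ℕ.+ (∣ S ∣ ℕ.+ k)) (ℕ.+-identityʳ ∣ S ∣) ⟨
      3 ℕ.* ∣ S ∣ ∎
      where
      open ℕ.≤-Reasoning
      L₀ = proj₁ (class-members 0)
      L₁ = proj₁ (class-members 1)
      L₂ = proj₁ (class-members 2)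
      short : ∀ r → length (proj₁ (class-members r)) ℕ.≤ ∣ S ∣
      short r = ℕ.≤-trans (proj₁ (proj₂ (class-members r))) positions≤S
      covered : ∀ r {x i} → x ℕ.< n → At r x i → x ∈ proj₁ (class-members r)
      covered r = proj₂ (proj₂ (class-members r))
      cover : ∀ {i} → i Subset.∈ M → ∃[ x ] x ∈ L₀ ++ L₁ ++ L₂ × ord x ≡ toℕ i
      cover {i} i∈M with surjective (Fin.toℕ<n i)
      ... | x , x<n , eq with class-mod3 (bounded x<n)
      ...   | k , cl with mod3-cases k
      ...     | inj₁ k≡0        = x , ∈-++⁺ˡ (covered 0 x<n (eq , i∈M , trans cl k≡0)) , eq
      ...     | inj₂ (inj₁ k≡1) = x , ∈-++⁺ʳ L₀ (∈-++⁺ˡ (covered 1 x<n (eq , i∈M , trans cl k≡1))) , eq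
      ...     | inj₂ (inj₂ k≡2) = x , ∈-++⁺ʳ L₀ (∈-++⁺ʳ L₁ (covered 2 x<n (eq , i∈M , trans cl k≡2))) , eq

-- Assembling the phases of the program

padded-toℕ : ∀ {A : Set} {n} (d : A) (f : Fin n → A) i → padded d f (toℕ i) ≡ f i
padded-toℕ d f zero    = refl
padded-toℕ d f (suc i) = padded-toℕ d (f ∘ suc) i

module Correctness (ℝ : Reals) {n : ℕ} (D : Fin n → Plane.UnitDisk ℝ) where
  open RealRAM ℝ
  private module R = Reals ℝ
  open ProgramLogic ℝ

  ρ : Name → ℕ → R.Carrier
  ρ = rarr (input D)

  module Strip = Strips ℝ n (ρ xs) (ρ ys)

  Unchanged : State → Set
  Unchanged τ = nreg τ numDisks ≡ n × rarr τ ≡ ρ × narr τ chosen ≡ (λ _ → 0) ×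
    (∀ a → narr τ (2 ℕ.+ a) ≡ λ _ → 0)

  initialise-correct : Terminates n initialise
    (λ τ → Permutation n (narr τ order) × Unchanged τ) (input D)
  initialise-correct = consequence
    (λ (τ0 , identity , rest) → permutation identity , τ0 , rest)
    (for-rule n Inv (λ ()) refl (n≤[1+n]^1 n) (λ _ _ _ inv → inv) ((λ _ ()) , refl , refl , λ _ → refl)
      λ { k τ k<n refl τ0 (identity , rest) → []≔ⁿ-rule (refl , τ0 , extend identity , rest) })
    where
    Identity : ℕ → (ℕ → ℕ) → Set
    Identity k f = ∀ q → q ℕ.< k → f q ≡ q
    Inv : ℕ → State → Set
    Inv k τ = Identity k (narr τ order) × rarr τ ≡ ρ × narr τ chosen ≡ (λ _ → 0) ×
      (∀ a → narr τ (2 ℕ.+ a) ≡ λ _ → 0)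
    extend : ∀ {k f} → Identity k f → Identity (suc k) (update f k k)
    extend {k} {f} identity q q<1+k with q ℕ.≟ k
    ... | yes refl = refl
    ... | no q≢k   = identity q (ℕ.≤∧≢⇒< (ℕ.≤-pred q<1+k) q≢k)
    permutation : ∀ {f} → Identity n f → Permutation n f
    permutation identity = record
      { bounded    = λ q<n → subst (ℕ._< n) (sym (identity _ q<n)) q<n
      ; injective  = λ p<n q<n eq → trans (sym (identity _ p<n)) (trans eq (identity _ q<n))
      ; surjective = λ u<n → _ , u<n , identity _ u<n
      }

  Correct : State → Set
  Correct τ = InducesBipartite (intersectionGraph D) (output τ) ×
    (∀ M → IsMBS (intersectionGraph D) M → ∣ M ∣ ℕ.≤ 3 ℕ.* ∣ output {n} τ ∣)

  byHeight-eval : ∀ τ → rarr τ ≡ ρ →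
    evalᵇ byHeight τ ≡ narr τ order (nreg τ outer) Strip.≤h narr τ order (nreg τ inner)
  byHeight-eval τ = cong λ r → does (z r outer R.≤? z r inner)
    where
    z : (Name → ℕ → R.Carrier) → Name → R.Carrier
    z r i = r ys (narr τ order (nreg τ i)) R.+ r ys (narr τ order (nreg τ i))

  byStrip-eval : ∀ τ ST → rarr τ ≡ ρ → narr τ stripOf ≡ ST → evalᵇ byStrip τ ≡
    StripOrder._⊑_ ℝ ST (ρ xs) (narr τ order (nreg τ outer)) (narr τ order (nreg τ inner))
  byStrip-eval τ _ ρ≡ refl = cong (λ r → StripOrder._⊑_ ℝ (narr τ stripOf) (r xs) (v outer) (v inner)) ρ≡
    where
    v : Name → ℕ
    v i = narr τ order (nreg τ i)

  program-correct : Terminates n program Correct (input D)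
  program-correct =
    ⨾-rule initialise-correct λ τ₁ (perm₁ , τ0 , ρ₁ , chosen₁ , zero₁) →
    ⨾-rule (Sorting.sort-correct ℝ n Strip._≤h_ Strip.≤h-total Strip.≤h-trans
        (λ τ ρ≡ _ → byHeight-eval τ (trans ρ≡ ρ₁))
        τ0 perm₁)
      λ τ₂ (τ0 , perm₂ , byHeight₂ , ρ₂ , chosen₂ , zero₂) →
    ⨾-rule (Strip.assignStrips-correct τ0 (cong (λ r → r ys) (trans ρ₂ ρ₁)) perm₂ byHeight₂)
      λ τ₃ (τ0 , separated₃ , class₃ , ρ₃ , order₃ , chosen₃ , zero₃) →
    let ρ₃′ = trans ρ₃ (trans ρ₂ ρ₁)
        ST = narr τ₃ stripOf
        CL = narr τ₃ classOf
        open StripOrder ℝ ST (ρ xs)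
        -- Separation and classes are known along the order by height. Surjectivity restates them
        -- for the disks themselves, because the second sort changes that order.
        at : ∀ {u} → u ℕ.< n → ∃[ q ] q ℕ.< n × narr τ₂ order q ≡ u
        at = Permutation.surjective perm₂
        separated : ∀ {u w} → u ℕ.< n → w ℕ.< n → Strip.Separated ST CL u w
        separated u<n w<n =
          let p , p<n , p≡ = at u<n
              q , q<n , q≡ = at w<n
          in subst₂ (Strip.Separated ST CL) p≡ q≡ (separated₃ p<n q<n)
        class-mod3 : ∀ {u} → u ℕ.< n → ∃[ k ] CL u ≡ mod3 k
        class-mod3 u<n =
          let p , p<n , p≡ = at u<n
              k , eq = class₃ p<n
          in k , trans (cong CL (sym p≡)) eq
    in
    ⨾-rule (Sorting.sort-correct ℝ n _⊑_ (λ {u} {w} → ⊑-total {u} {w}) (λ {u} {v} {w} → ⊑-trans {u} {v} {w})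
        (λ τ ρ≡ arrays → byStrip-eval τ ST (trans ρ≡ ρ₃′) (arrays 0))
        τ0 (subst (Permutation n) (sym order₃) perm₂))
      λ τ₄ (τ0 , perm₄ , byStrip₄ , ρ₄ , chosen₄ , arrays₄) →
    -- No phase so far writes to the arrays of the table, so row 0 still holds zeros and is the pair
    -- of empty chains.
    let zero₄ = λ a →
          trans (arrays₄ (2 ℕ.+ a)) (trans (zero₃ a) (trans (zero₂ (2 ℕ.+ a)) (zero₁ (2 ℕ.+ a))))
    in
    ⨾-rule (Building.buildTable-correct ℝ n ρ (narr τ₄ order) CL τ0
        (trans ρ₄ ρ₃′ , refl , arrays₄ 1 , trans chosen₄ (trans chosen₃ (trans chosen₂ chosen₁)))
        (cong (λ f → f 0) (zero₄ 0)) (cong (λ f → f 0) (zero₄ 1)) (cong (λ f → f 0) (zero₄ 2)))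
      λ τ₅ (τ0 , context , table) →
    consequence (λ {τ} extracted →
        let open Approximation ℝ n D ρ (padded-toℕ _ _) (padded-toℕ _ _)
              (narr τ₄ order) ST CL perm₄ separated byStrip₄ class-mod3 (narr τ chosen) extracted
        in bipartite , λ M (bip , _) → ∣M∣≤3∣S∣ M bip)
      (Building.extract-correct ℝ n ρ (narr τ₄ order) CL τ0 context table)

open import Data.Nat using (_*_; _^_; _≤_)

theorem21 : (ℝ : Reals) → let open RealRAM ℝ in
    ∃[ P ] ∃[ T ] (T ∈O λ n → n ^ 4) ×
    (∀ (n : ℕ) (D : Fin n → UnitDisk) → Injective _≡_ SameDisk D →
    ∃[ S ] (P on D outputs S within T n) ×
    InducesBipartite (intersectionGraph D) S ×
    (∀ (M : Subset n) → IsMBS (intersectionGraph D) M → ∣ M ∣ ≤ 3 * ∣ S ∣))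
-- `degree program` computes to 4: the loops over `outer` and `inner` contribute 1 each, the scan
-- below `old` contributes 2, and every other phase has degree at most 2.
theorem21 ℝ = program , (λ n → bound n program) , bound∈O program , λ n D _ →
  let open RealRAM ℝ
      open ProgramLogic ℝ
      halts (t , τ , run , t≤ , bipartite , approximates) = Correctness.program-correct ℝ D
  in output τ , (t , τ , run , t≤ , refl) , bipartite , approximates
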